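{- There exists an absolute constant $c>0$ such that the following holds for every prime $p$. Let $\mathcal{I}=\{n+1,n+2,\ldots,n+N\}\pmod p\subset\mathbb{F}_p$ be an interval with $|\mathcal{I}|<cp$, and suppose $\mathcal{I}$ has a nontrivial multiplicative decomposition. Then either $$\mathcal{I}=\pm\{3^*-1,\,3^*,\,3^*+1\}\pmod p,$$ or $$\mathcal{I}=-\mathcal{I}.$$ Moreover, in the latter case, for any sets $\mathcal{A},\mathcal{B}\subset\mathbb{F}_p$ with $|\mathcal{A}|\ge2$, $|\mathcal{B}|\ge2$ and $\mathcal{I}\setminus\{0\}=\mathcal{A}\mathcal{B}$, one of the sets $\mathcal{A}$ or $\mathcal{B}$ coincides with $\{ -r,r\}$ for some residue class $r\in\mathbb{F}_p$.
   Context: $\mathbb{F}_p$ is the field of residues modulo the prime $p$. For $\mathcal{A},\mathcal{B}\subset\mathbb{F}_p$, $\mathcal{A}\mathcal{B}=\{ab:\ a\in\mathcal{A},\ b\in\mathcal{B}\}$, and $-\mathcal{S}=\{ -s: s\in\mathcal{S}\}$. An interval in $\mathbb{F}_p$ is a set of the form $\{n+1,n+2,\ldots,n+N\}\pmod p$ with integers $n$ and $N\ge 1$. A set $\mathcal{S}\subset\mathbb{F}_p$ is said to have a nontrivial multiplicative decomposition if $\mathcal{S}\setminus\{0\}=\mathcal{A}\mathcal{B}$ for some sets $\mathcal{A},\mathcal{B}\subset\mathbb{F}_p$ with $|\mathcal{A}|\ge2$ and $|\mathcal{B}|\ge2$. For an integer $m$ not divisible by $p$, $m^*$ denotes the multiplicative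 inverse of $m$ modulo $p$. -}

module Defs where

open import Data.Nat using (ℕ; zero; suc; _+_; _*_; _∸_; _≤_; NonZero)
open import Data.Nat.DivMod using (_mod_)
open import Data.Fin using (Fin; toℕ)
open import Data.Fin.Subset using (Subset; ⁅_⁆; _∪_; _∈_)
import Data.Fin.Subset as S
open import Data.Product using (Σ; _×_; ∃)
open import Data.Sum using (_⊎_)
open import Relation.Binary.PropositionalEquality using (_≡_; _≢_)
open import Relation.Nullary using (¬_)
open import Function.Bundles using (_⇔_)

-- Elements of 𝔽_p are represented by Fin p (residues 0 … p-1);
-- subsets of 𝔽_p by Data.Fin.Subset (characteristic vectors), with
-- cardinality ∣_∣ from Data.Fin.Subset.

module _ (p : ℕ) .{{_ : NonZero p}} where

  [_] : ℕ → Fin p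
  [ k ] = k mod p

  mulF : Fin p → Fin p → Fin p
  mulF a b = [ toℕ a * toℕ b ]

  negF : Fin p → Fin p
  negF a = [ p ∸ toℕ a ]

  addOne : Fin p → Fin p
  addOne a = [ toℕ a + 1 ]

  subOne : Fin p → Fin p
  subOne a = [ toℕ a + (p ∸ 1) ]

  zeroF : Fin p
  zeroF = [ 0 ]

  -- the interval {n+1, …, n+N} (mod p), built as the union of the
  -- singletons {n+k mod p} for k = 1 … N  (with n ∈ ℕ; every integer
  -- shift is congruent mod p to a natural number)
  intervalUpTo : ℕ → ℕ → Subset p
  intervalUpTo n zero    = S.⊥
  intervalUpTo n (suc k) = ⁅ [ n + suc k ] ⁆ ∪ intervalUpTo n k

  interval : (n N : ℕ) → Subset p
  interval n N = intervalUpTo n N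

  InProd : Subset p → Subset p → Fin p → Set
  InProd A B x = Σ (Fin p) λ a → Σ (Fin p) λ b → a ∈ A × b ∈ B × x ≡ mulF a b

  MinusZeroIsProd : Subset p → Subset p → Subset p → Set
  MinusZeroIsProd I A B = ∀ x → ((x ∈ I × x ≢ zeroF) ⇔ InProd A B x)

  HasNontrivialDecomp : Subset p → Set
  HasNontrivialDecomp I =
    Σ (Subset p) λ A → Σ (Subset p) λ B →
      2 ≤ S.∣ A ∣ × 2 ≤ S.∣ B ∣ × MinusZeroIsProd I A B

  SameAs : Subset p → (Fin p → Set) → Set
  SameAs X P = ∀ x → (x ∈ X ⇔ P x)

  NegSymmetric : Subset p → Set
  NegSymmetric X = ∀ x → (x ∈ X ⇔ negF x ∈ X)

  IsTriple : Subset p → Fin p → Set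
  IsTriple X t = SameAs X (λ x → x ≡ subOne t ⊎ x ≡ t ⊎ x ≡ addOne t)

  IsNegTriple : Subset p → Fin p → Set
  IsNegTriple X t =
    SameAs X (λ x → x ≡ negF (subOne t) ⊎ x ≡ negF t ⊎ x ≡ negF (addOne t))

  IsInvThree : Fin p → Set
  IsInvThree t = mulF [ 3 ] t ≡ [ 1 ]

  IsPlusMinus : Subset p → Fin p → Set
  IsPlusMinus X r = SameAs X (λ x → x ≡ r ⊎ x ≡ negF r)

{-# OPTIONS --safe #-}

-- Write I = ν + {0, …, N-1} and ab = ν + r(a,b) with 0 ≤ r(a,b) < N.  For b, b' ∈ B the dilates
-- a(b - b') are represented by the small integers r(a,b) - r(a,b').  If two of the vectors
-- (r(a,b) - r(a,b'))_a were not proportional, they would span a two-dimensional family Y of about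
-- |B| (p/N)² residues for which AY still lies in an interval of length below p/4.  A second moment
-- (large sieve) bound gives |A||Y| ≤ 4p, which contradicts |A||B| ≥ N - 1 once p/N is large.  Hence
-- all these vectors are proportional, and a closest pair b, b' gives x with |xa| ≤ N/(|B| - 1) for
-- all a ∈ A; likewise |yb| ≤ N/(|A| - 1).  So the integers (xa)(yb) are O(N), no reduction modulo p
-- takes place, and the problem becomes one about integer sets whose product set is an arithmetic
-- progression without 0.  Comparing the two terms of largest absolute value settles that case.

module Submission where

open import Defs
open import Data.Bool using (true; false; if_then_else_)
open import Data.Empty using (⊥; ⊥-elim)
open import Data.Fin using (Fin; zero; suc; toℕ; fromℕ<; punchIn; punchOut; combine; remQuot)
open import Data.Fin.Properties using (toℕ-injective; toℕ-fromℕ<; fromℕ<-injective; toℕ<n; punchOut-injective; punchIn-punchOut; punchInᵢ≢i; pigeonhole; injective⇒≤; combine-injective; combine-remQuot; any?; all?) renaming (_≟_ to _≟ᶠ_; suc-injective to sucᶠ-injective; <⇒≢ to <ᶠ⇒≢)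
open import Data.Fin.Subset using (Subset; inside; outside; _∈_; ⁅_⁆) renaming (∣_∣ to card)
open import Data.Fin.Subset.Properties using (x∈p∪q⁻; x∈p∪q⁺; x∈⁅x⁆; x∈⁅y⁆⇒x≡y; ∉⊥; _∈?_)
open import Data.Integer hiding (suc; NonZero)
import Data.Integer.Divisibility.Signed as Signed
open import Data.Integer.DivMod using (n%ℕd<d; a≡a%ℕn+[a/ℕn]*n)
open import Data.Integer.Properties
open import Algebra.Properties.Semiring.Sum +-*-semiring using (sum; sum-cong-≗; sum-remove; ∑-comm; *-distribˡ-sum; *-distribʳ-sum)
open import Data.Integer.Tactic.RingSolver using (solve-∀)
open import Data.Nat as ℕ using (ℕ; zero; suc; z≤n; s≤s; NonZero)
open import Data.Nat.Coprimality using (1-coprimeTo)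
import Data.Nat.Divisibility as ℕ
import Data.Nat.DivMod as ℕ
open import Data.Nat.Primality using (Prime; euclidsLemma)
import Data.Nat.Properties as ℕ
open import Data.Nat.Tactic.RingSolver using () renaming (solve-∀ to solveℕ-∀)
open import Data.Product using (Σ; ∃; _×_; _,_; proj₁; proj₂)
open import Data.Rational as ℚ using (ℚ; mkℚ; 0ℚ; *<*)
import Data.Rational.Properties as ℚ
open import Data.Rational.Unnormalised using (mkℚᵘ)
import Data.Rational.Unnormalised.Properties as ℚᵘ
open import Data.Sum as Sum using (_⊎_; inj₁; inj₂)
open import Data.Unit using (tt)
open import Data.Vec using ([]; _∷_; here; there)
open import Function using (_∘_; _⇔_; mk⇔; Equivalence)
open import Function.Definitions using (Injective)
open import Relation.Binary using (Tri; tri<; tri≈; tri>)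
open import Relation.Binary.PropositionalEquality using (_≡_; _≢_; refl; sym; trans; cong; cong₂; subst; subst₂; module ≡-Reasoning)
open import Relation.Nullary using (¬_; Dec; yes; no)
open import Relation.Nullary.Decidable using (map′; _×-dec_; _⊎-dec_; _→-dec_)

-- Products of integers forming an arithmetic progression

-- The sieve needs two independent directions. Extending `B` along one difference multiplies its
-- size by about `p/N`; when `|A||B|` is of order `N`, the product of the two sizes is then of order
-- `p`, which a bound `4p` allows. A second direction supplies another factor `p/N` and with it the
-- contradiction. Proportionality, in turn, is what lets a single dilation make all of `A` small at
-- once. The exceptional triple is a factorisation already present in the integers:
-- `{2, -1}{2, -1} = {4, 1, -2}` is a progression of step `3`, and with `t = 3*` its dilate by `t`
-- is `{t + 1, t, t - 1}`. In every other case one factor is `{r, -r}`, which makes the product set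
-- symmetric.

0≤* : ∀ {x y} → 0ℤ ≤ x → 0ℤ ≤ y → 0ℤ ≤ x * y
0≤* {+ m} {+ n} _ _ = subst (0ℤ ≤_) (pos-* m n) (+≤+ z≤n)

0<* : ∀ {x y} → 0ℤ < x → 0ℤ < y → 0ℤ < x * y
0<* {+[1+ m ]} {+[1+ n ]} _ _ = +<+ (s≤s z≤n)
0<* {+0} (+<+ ())
0<* {_} {+0} _ (+<+ ())

0<⇒≢0 : ∀ {x} → 0ℤ < x → x ≢ 0ℤ
0<⇒≢0 0<x refl = <-irrefl refl 0<x

*-≢0 : ∀ {x y} → x ≢ 0ℤ → y ≢ 0ℤ → x * y ≢ 0ℤ
*-≢0 {x} x≢0 y≢0 xy≡0 with i*j≡0⇒i≡0∨j≡0 x xy≡0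
... | inj₁ x≡0 = x≢0 x≡0
... | inj₂ y≡0 = y≢0 y≡0

*-cancelʳ : ∀ {x y z} → z ≢ 0ℤ → x * z ≡ y * z → x ≡ y
*-cancelʳ {x} {y} {z} z≢0 = *-cancelʳ-≡ x y z {{≢-nonZero z≢0}}

*-cancelˡ : ∀ {x y z} → z ≢ 0ℤ → z * x ≡ z * y → x ≡ y
*-cancelˡ {x} {y} {z} z≢0 = *-cancelˡ-≡ z x y {{≢-nonZero z≢0}}

*-cancelʳ-< : ∀ {x y z} → 0ℤ < z → x * z < y * z → x < y
*-cancelʳ-< {x} {y} {z} 0<z = *-cancelʳ-<-nonNeg {x} {y} z {{nonNegative (<⇒≤ 0<z)}}

*-cancelʳ-≤ : ∀ {x y z} → 0ℤ < z → x * z ≤ y * z → x ≤ y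
*-cancelʳ-≤ {x} {y} {z} 0<z = *-cancelʳ-≤-pos x y z {{positive 0<z}}

0<*⇒0<ˡ : ∀ {x y} → 0ℤ < y → 0ℤ < x * y → 0ℤ < x
0<*⇒0<ˡ {x} {y} 0<y 0<xy = *-cancelʳ-< 0<y (subst (_< x * y) (sym (*-zeroˡ y)) 0<xy)

-∣i∣≤i : ∀ i → - (+ ∣ i ∣) ≤ i
-∣i∣≤i (+ n) = ≤-trans (neg-≤-pos {n} {0}) (+≤+ z≤n)
-∣i∣≤i -[1+ n ] = ≤-refl

i≤∣i∣ : ∀ i → i ≤ + ∣ i ∣
i≤∣i∣ (+ n) = ≤-refl
i≤∣i∣ -[1+ n ] = -≤+

0<⇒+∣∣ : ∀ {x} → 0ℤ < x → + ∣ x ∣ ≡ x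
0<⇒+∣∣ 0<x = 0≤i⇒+∣i∣≡i (<⇒≤ 0<x)

small-multiple : ∀ {x b} q → x ≡ q * b → ∣ x ∣ ℕ.≤ ∣ b ∣ → x ≢ 0ℤ → x ≡ b ⊎ x ≡ - b
small-multiple {x} {b} q x≡qb ∣x∣≤∣b∣ x≢0 = go q x≡qb ∣q∣≤1
  where
  b≢0 : b ≢ 0ℤ
  b≢0 refl = x≢0 (trans x≡qb (*-zeroʳ q))
  ∣q∣≤1 : ∣ q ∣ ℕ.≤ 1
  ∣q∣≤1 = ℕ.*-cancelʳ-≤ (∣ q ∣) 1 (∣ b ∣) {{≢-nonZero b≢0}}
    (subst₂ ℕ._≤_ (trans (cong ∣_∣ x≡qb) (abs-* q b)) (sym (ℕ.*-identityˡ ∣ b ∣)) ∣x∣≤∣b∣)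
  go : ∀ q → x ≡ q * b → ∣ q ∣ ℕ.≤ 1 → x ≡ b ⊎ x ≡ - b
  go (+ 0) eq _ = ⊥-elim (x≢0 (trans eq (*-zeroˡ b)))
  go (+ 1) eq _ = inj₁ (trans eq (*-identityˡ b))
  go -[1+ 0 ] eq _ = inj₂ (trans eq (-1*i≡-i b))
  go (+ suc (suc _)) _ (s≤s ())
  go -[1+ suc _ ] _ (s≤s ())

zero-difference : ∀ {x y} c → x ≡ y → c * (x - y) ≡ 0ℤ
zero-difference {x} c refl = trans (cong (c *_) (+-inverseʳ x)) (*-zeroʳ c)

-- Linear arithmetic by hand: the multipliers are supplied explicitly, and the last argument is a
-- polynomial identity for `solve-∀`. The congruence versions `≈-combine₁` to `≈-combine₃` follow
-- the same pattern.
combine₁ : ∀ {g h x y} c → x ≡ y → g - h ≡ c * (x - y) → g ≡ h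
combine₁ {g} {h} c e eq = i-j≡0⇒i≡j g h (trans eq (zero-difference c e))

combine₂ : ∀ {g h x y x' y'} c c' → x ≡ y → x' ≡ y' → g - h ≡ c * (x - y) + c' * (x' - y') → g ≡ h
combine₂ {g} {h} c c' e e' eq =
  i-j≡0⇒i≡j g h (trans eq (cong₂ _+_ (zero-difference c e) (zero-difference c' e')))

combine₃ : ∀ {g h x y x' y' x″ y″} c c' c″ → x ≡ y → x' ≡ y' → x″ ≡ y″ →
  g - h ≡ c * (x - y) + c' * (x' - y') + c″ * (x″ - y″) → g ≡ h
combine₃ {g} {h} c c' c″ e e' e″ eq =
  i-j≡0⇒i≡j g h (trans eq (cong₂ _+_ (cong₂ _+_ (zero-difference c e) (zero-difference c' e')) (zero-difference c″ e″)))

0<x+1⇒0≤x : ∀ x → 0ℤ < x + 1ℤ → 0ℤ ≤ x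
0<x+1⇒0≤x (+ n) _ = +≤+ z≤n
0<x+1⇒0≤x -[1+ 0 ] (+<+ ())
0<x+1⇒0≤x -[1+ suc n ] ()

-- The hypotheses say a = ku, α = (1 - k)u, b = kv, β = (1 - k)v and s = (2k - 1)uv with u = a + α, v = b + β.
classify : ∀ {a b α β γ s} k c c' → 0ℤ < b → α < 0ℤ → 0ℤ < s → 0ℤ < k → 0ℤ ≤ c →
  α * b ≡ a * b - k * s → s ≡ (a + α) * (b - β) → a ≡ k * (a + α) → b ≡ k * (b + β) →
  γ * b ≡ a * b - c * s → γ * β ≡ a * b - c' * s → c * s ≤ + 2 * (a * b) → γ ≡ a ⊎ γ ≡ α
classify {a} {b} {α} {β} {γ} {s} k c c' 0<b α<0 0<s 0<k 0≤c αb s≡ a≡ b≡ γb γβ c≤ = go q c≡ γ≡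
  where
  b≢0 = 0<⇒≢0 0<b
  m q u d : ℤ
  m = c' - c
  -- Witness that `k` divides `c`: since `d = (2k - 1)v`, the equation `m * b ≡ k * b - c * d` says
  -- `mk = k² - (2k - 1)c`, that is `c = k(m - k + 2c)`.
  q = m - k + + 2 * c
  u = a + α
  d = b - β
  ud≢0 : u * d ≢ 0ℤ
  ud≢0 ud≡0 = 0<⇒≢0 0<s (trans s≡ ud≡0)
  u≢0 : u ≢ 0ℤ
  u≢0 u≡0 = ud≢0 (trans (cong (_* d) u≡0) (*-zeroˡ d))
  d≢0 : d ≢ 0ℤ
  d≢0 d≡0 = ud≢0 (trans (cong (u *_) d≡0) (*-zeroʳ u))
  -- Subtracting the two equations for `γ` leaves `γd = ms = mud`.
  γ≡mu : γ ≡ m * u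
  γ≡mu = *-cancelʳ d≢0 (combine₃ 1ℤ -1ℤ m γb γβ s≡ (id a b α β γ s c c'))
    where
    id : ∀ a b α β γ s c c' → γ * (b - β) - (c' - c) * (a + α) * (b - β) ≡
      1ℤ * (γ * b - (a * b - c * s)) + -1ℤ * (γ * β - (a * b - c' * s)) + (c' - c) * (s - (a + α) * (b - β))
    id = solve-∀
  mb : m * b ≡ k * b - c * d
  mb = *-cancelʳ u≢0 (combine₂ 1ℤ 1ℤ (trans (cong (_* b) (sym γ≡mu)) γb)
    (cong₂ (λ x y → x * b - c * y) a≡ s≡) (id a b d k u m c s))
    where
    id : ∀ a b d k u m c s → m * b * u - (k * b - c * d) * u ≡
      1ℤ * (m * u * b - (a * b - c * s)) + 1ℤ * (a * b - c * s - (k * u * b - c * (u * d)))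
    id = solve-∀
  c≡ : c ≡ k * q
  c≡ = *-cancelʳ b≢0 (combine₂ c (- k) b≡ mb (id b β k c m))
    where
    id : ∀ b β k c m → c * b - k * (m - k + + 2 * c) * b ≡
      c * (b - k * (b + β)) + - k * (m * b - (k * b - c * (b - β)))
    id = solve-∀
  γ≡ : γ ≡ a - q * (a - α)
  γ≡ = *-cancelʳ b≢0 (combine₃ 1ℤ (- s) (- q) γb c≡ αb (id a b α γ s k c q))
    where
    id : ∀ a b α γ s k c q → γ * b - (a - q * (a - α)) * b ≡
      1ℤ * (γ * b - (a * b - c * s)) + - s * (c - k * q) + - q * (α * b - (a * b - k * s))
    id = solve-∀
  go : ∀ q → c ≡ k * q → γ ≡ a - q * (a - α) → γ ≡ a ⊎ γ ≡ α
  go (+ 0) _ eq = inj₁ (trans eq (id a α))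
    where
    id : ∀ a α → a - 0ℤ * (a - α) ≡ a
    id = solve-∀
  go (+ 1) _ eq = inj₂ (trans eq (id a α))
    where
    id : ∀ a α → a - 1ℤ * (a - α) ≡ α
    id = solve-∀
  go (+ suc (suc n)) c≡kq _ = ⊥-elim (<-irrefl refl (<-≤-trans negative-sum nonneg))
    where
    -- 0 ≤ 2ab - cs = 2αb - nks, where αb < 0.
    nonneg : 0ℤ ≤ + 2 * (a * b) - c * s
    nonneg = i≤j⇒0≤j-i c≤
    id : ∀ a b α s k c n → + 2 * (a * b) - c * s - (+ 2 * (α * b) + - (n * (k * s))) ≡
      - s * (c - k * (+ 2 + n)) + - (+ 2) * (α * b - (a * b - k * s))
    id = solve-∀
    eq : + 2 * (a * b) - c * s ≡ + 2 * (α * b) + - (+ n * (k * s))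
    eq = combine₂ (- s) (- (+ 2)) c≡kq αb (id a b α s k c (+ n))
    αb<0 : α * b < 0ℤ
    αb<0 = subst (α * b <_) (*-zeroˡ b) (*-monoʳ-<-pos b {{positive 0<b}} α<0)
    negative-sum : + 2 * (a * b) - c * s < 0ℤ
    negative-sum = subst (_< 0ℤ) (sym eq) (+-mono-<-≤ (*-monoˡ-<-pos (+ 2) αb<0)
      (neg-mono-≤ (0≤* {+ n} (+≤+ z≤n) (<⇒≤ (0<* 0<k 0<s)))))
  go -[1+ n ] c≡kq _ = ⊥-elim (<-irrefl refl (<-≤-trans
    (subst (_< 0ℤ) (sym c≡kq) (subst (k * -[1+ n ] <_) (*-zeroʳ k) (*-monoˡ-<-pos k {{positive 0<k}} -<+))) 0≤c))

n²+2n≢1 : ∀ n → + n * + n + + 2 * + n - 1ℤ ≢ 0ℤ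
n²+2n≢1 zero ()
n²+2n≢1 (suc n) eq with () ← trans (sym (ℕ.+-suc (n ℕ.+ n ℕ.* suc n) _)) (+-injective eq)

module Extremal {I J : Set} (P : I → ℤ) (R : J → ℤ) (i₀ : I) (j₀ : J) (N : ℕ) (s : ℤ)
  (0<a : 0ℤ < P i₀) (0<b : 0ℤ < R j₀) (0<s : 0ℤ < s)
  (∣P∣≤ : ∀ i → ∣ P i ∣ ℕ.≤ ∣ P i₀ ∣) (∣R∣≤ : ∀ j → ∣ R j ∣ ℕ.≤ ∣ R j₀ ∣)
  (P≢0 : ∀ i → P i ≢ 0ℤ) (R≢0 : ∀ j → R j ≢ 0ℤ)
  (product∈AP : ∀ i j → ∃ λ m → m ℕ.< N × P i * R j ≡ P i₀ * R j₀ - + m * s)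
  where

  private
    a b X : ℤ
    a = P i₀
    b = R j₀
    X = a * b

    0<X : 0ℤ < X
    0<X = 0<* 0<a 0<b

    s≢0 : s ≢ 0ℤ
    s≢0 = 0<⇒≢0 0<s

    index : I → J → ℤ
    index i j = + proj₁ (product∈AP i j)

    index-eq : ∀ i j → P i * R j ≡ X - index i j * s
    index-eq i j = proj₂ (proj₂ (product∈AP i j))

    R≤b : ∀ j → R j ≤ b
    R≤b j = ≤-trans (i≤∣i∣ (R j)) (≤-trans (+≤+ (∣R∣≤ j)) (≤-reflexive (0<⇒+∣∣ 0<b)))

    -a≤P : ∀ i → - a ≤ P i
    -a≤P i = ≤-trans (neg-mono-≤ (≤-trans (+≤+ (∣P∣≤ i)) (≤-reflexive (0<⇒+∣∣ 0<a)))) (-∣i∣≤i (P i))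

    -b≤R : ∀ j → - b ≤ R j
    -b≤R j = ≤-trans (neg-mono-≤ (≤-trans (+≤+ (∣R∣≤ j)) (≤-reflexive (0<⇒+∣∣ 0<b)))) (-∣i∣≤i (R j))

    -X≤product : ∀ i j → - X ≤ P i * R j
    -X≤product i j = ≤-trans
      (neg-mono-≤ (≤-trans (+≤+ (subst₂ ℕ._≤_ (sym (abs-* (P i) (R j))) (sym (abs-* a b))
        (ℕ.*-mono-≤ (∣P∣≤ i) (∣R∣≤ j)))) (≤-reflexive (0<⇒+∣∣ 0<X)))) (-∣i∣≤i (P i * R j))

    index-≤ : ∀ i j → index i j * s ≤ + 2 * X
    index-≤ i j = 0≤i-j⇒j≤i (subst (0ℤ ≤_) e (i≤j⇒0≤j-i (-X≤product i j)))
      where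
      m = index i j
      e : P i * R j - - X ≡ + 2 * X - m * s
      e = trans (cong (_- - X) (index-eq i j)) (id X m s)
        where
        id : ∀ X m s → X - m * s - - X ≡ + 2 * X - m * s
        id = solve-∀

  Conclusion : Set
  Conclusion = (∀ i → P i ≡ a ⊎ P i ≡ - a) ⊎ (∀ j → R j ≡ b ⊎ R j ≡ - b) ⊎ (N ≡ 3 × + 4 * s ≡ + 3 * X)

  private
    R-multiple : ∀ d j k → d ≢ 0ℤ → s ≡ b * d → R j * d ≡ k * s → R j ≡ b ⊎ R j ≡ - b
    R-multiple d j k d≢0 s≡ eq = small-multiple k
      (*-cancelʳ d≢0 (trans eq (trans (cong (k *_) s≡) (sym (*-assoc k b d))))) (∣R∣≤ j) (R≢0 j)

    P-multiple : ∀ d i k → d ≢ 0ℤ → s ≡ a * d → P i * d ≡ k * s → P i ≡ a ⊎ P i ≡ - a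
    P-multiple d i k d≢0 s≡ eq = small-multiple k
      (*-cancelʳ d≢0 (trans eq (trans (cong (k *_) s≡) (sym (*-assoc k a d))))) (∣P∣≤ i) (P≢0 i)

    factor≢0 : ∀ x d → s ≡ x * d → d ≢ 0ℤ
    factor≢0 x d s≡ d≡0 = s≢0 (trans s≡ (trans (cong (x *_) d≡0) (*-zeroʳ x)))

    -- Differences of products are multiples of `s`. In particular `R j * (a - P i)` is one, so
    -- `R j` is an integer multiple of `b`, and maximality of `b` leaves only `± b`.
    R-from-gap : ∀ i → s ≡ b * (a - P i) → ∀ j → R j ≡ b ⊎ R j ≡ - b
    R-from-gap i s≡ j = R-multiple (a - P i) j (index i j - index i₀ j) (factor≢0 b _ s≡) s≡
      (trans (id₁ (R j) a (P i)) (trans (cong₂ _-_ (index-eq i₀ j) (index-eq i j)) (id₂ X (index i₀ j) (index i j) s)))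
      where
      id₁ : ∀ r a α → r * (a - α) ≡ a * r - α * r
      id₁ = solve-∀
      id₂ : ∀ X k k' s → (X - k * s) - (X - k' * s) ≡ (k' - k) * s
      id₂ = solve-∀

    P-from-gap : ∀ j → s ≡ a * (b - R j) → ∀ i → P i ≡ a ⊎ P i ≡ - a
    P-from-gap j s≡ i = P-multiple (b - R j) i (index i j - index i j₀) (factor≢0 a _ s≡) s≡
      (trans (id₁ (P i) b (R j)) (trans (cong₂ _-_ (index-eq i j₀) (index-eq i j)) (id₂ X (index i j₀) (index i j) s)))
      where
      id₁ : ∀ r a α → r * (a - α) ≡ r * a - r * α
      id₁ = solve-∀
      id₂ : ∀ X k k' s → (X - k * s) - (X - k' * s) ≡ (k' - k) * s
      id₂ = solve-∀

    -- A sum of two products is `2X` modulo `s`. As `P i' ≡ - a` puts `- X` among the products, `2X`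
    -- is itself a multiple of `s`, and hence so is `P i * (b + R j)`.
    P-from-sum : ∀ i' j → P i' ≡ - a → s ≡ a * (b + R j) → ∀ i → P i ≡ a ⊎ P i ≡ - a
    P-from-sum i' j P≡-a s≡ i =
      P-multiple (b + R j) i (index i' j₀ - index i j₀ - index i j) (factor≢0 a _ s≡) s≡ (begin
        P i * (b + R j)                                   ≡⟨ *-distribˡ-+ (P i) b (R j) ⟩
        P i * b + P i * R j                               ≡⟨ cong₂ _+_ (index-eq i j₀) (index-eq i j) ⟩
        X - index i j₀ * s + (X - index i j * s)          ≡⟨ id₁ a b s (index i j₀) (index i j) ⟩
        X - - a * b - index i j₀ * s - index i j * s      ≡⟨ cong (λ x → X - x * b - index i j₀ * s - index i j * s) (sym P≡-a) ⟩
        X - P i' * b - index i j₀ * s - index i j * s     ≡⟨ cong (λ x → X - x - index i j₀ * s - index i j * s) (index-eq i' j₀) ⟩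
        X - (X - index i' j₀ * s) - index i j₀ * s - index i j * s ≡⟨ id₂ X s (index i' j₀) (index i j₀) (index i j) ⟩
        (index i' j₀ - index i j₀ - index i j) * s ∎)
      where
      open ≡-Reasoning
      id₁ : ∀ a b s k k' → a * b - k * s + (a * b - k' * s) ≡ a * b - - a * b - k * s - k' * s
      id₁ = solve-∀
      id₂ : ∀ X s l k k' → X - (X - l * s) - k * s - k' * s ≡ (l - k - k') * s
      id₂ = solve-∀

    R-from-sum : ∀ i j' → R j' ≡ - b → s ≡ b * (a + P i) → ∀ j → R j ≡ b ⊎ R j ≡ - b
    R-from-sum i j' R≡-b s≡ j =
      R-multiple (a + P i) j (index i₀ j' - index i₀ j - index i j) (factor≢0 b _ s≡) s≡ (begin
        R j * (a + P i)                                   ≡⟨ id₀ (R j) a (P i) ⟩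
        a * R j + P i * R j                               ≡⟨ cong₂ _+_ (index-eq i₀ j) (index-eq i j) ⟩
        X - index i₀ j * s + (X - index i j * s)          ≡⟨ id₁ a b s (index i₀ j) (index i j) ⟩
        X - a * - b - index i₀ j * s - index i j * s      ≡⟨ cong (λ x → X - a * x - index i₀ j * s - index i j * s) (sym R≡-b) ⟩
        X - a * R j' - index i₀ j * s - index i j * s     ≡⟨ cong (λ x → X - x - index i₀ j * s - index i j * s) (index-eq i₀ j') ⟩
        X - (X - index i₀ j' * s) - index i₀ j * s - index i j * s ≡⟨ id₂ X s (index i₀ j') (index i₀ j) (index i j) ⟩
        (index i₀ j' - index i₀ j - index i j) * s ∎)
      where
      open ≡-Reasoning
      id₀ : ∀ r a α → r * (a + α) ≡ a * r + α * r
      id₀ = solve-∀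
      id₁ : ∀ a b s k k' → a * b - k * s + (a * b - k' * s) ≡ a * b - a * - b - k * s - k' * s
      id₁ = solve-∀
      id₂ : ∀ X s l k k' → X - (X - l * s) - k * s - k' * s ≡ (l - k - k') * s
      id₂ = solve-∀

    -- Here a = ku and b = kv while the two negative factors are (1 - k)u and (1 - k)v; only k = 2 survives,
    -- which is the progression 4uv, uv, -2uv.
    both-negative : (∀ m → m ℕ.< N → X - + m * s ≡ 0ℤ ⊎ ∃ λ i → ∃ λ j → P i * R j ≡ X - + m * s) →
      ∀ i j → P i < 0ℤ → R j < 0ℤ → 0ℤ < a + P i → 0ℤ < b + R j → P i * R j ≡ X - + 1 * s → N ≡ 3 × + 4 * s ≡ + 3 * X
    both-negative AP∈product i j α<0 β<0 0<u 0<v αβ = conclude (proj₁ (product∈AP i₀ j)) (proj₁ (proj₂ (product∈AP i₀ j))) refl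
      where
      α β u v k k₂ : ℤ
      α = P i
      β = R j
      u = a + α
      v = b + β
      k = index i₀ j
      k₂ = index i j₀
      0<a-α : 0ℤ < a - α
      0<a-α = +-mono-< 0<a (neg-mono-< α<0)
      0<b-β : 0ℤ < b - β
      0<b-β = +-mono-< 0<b (neg-mono-< β<0)
      aβ : a * β ≡ X - k * s
      aβ = index-eq i₀ j
      αb' : α * b ≡ X - k₂ * s
      αb' = index-eq i j₀
      -- The positive number `u(b - β)` equals `(k - k₂ + 1)s`, so integrality gives the inequality;
      -- the mirror image `(a - α)v` gives the reverse one.
      k₂≤k : k₂ ≤ k
      k₂≤k = 0≤i-j⇒j≤i (0<x+1⇒0≤x (k - k₂) (0<*⇒0<ˡ 0<s (subst (0ℤ <_) eq (0<* 0<u 0<b-β))))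
        where
        id : ∀ a b α β k k₂ s → (a + α) * (b - β) - (k - k₂ + 1ℤ) * s ≡
          -1ℤ * (a * β - (a * b - k * s)) + 1ℤ * (α * b - (a * b - k₂ * s)) + -1ℤ * (α * β - (a * b - + 1 * s))
        id = solve-∀
        eq : (a + α) * (b - β) ≡ (k - k₂ + 1ℤ) * s
        eq = combine₃ -1ℤ 1ℤ -1ℤ aβ αb' αβ (id a b α β k k₂ s)
      k≤k₂ : k ≤ k₂
      k≤k₂ = 0≤i-j⇒j≤i (0<x+1⇒0≤x (k₂ - k) (0<*⇒0<ˡ 0<s (subst (0ℤ <_) eq (0<* 0<a-α 0<v))))
        where
        id : ∀ a b α β k k₂ s → (a - α) * (b + β) - (k₂ - k + 1ℤ) * s ≡
          1ℤ * (a * β - (a * b - k * s)) + -1ℤ * (α * b - (a * b - k₂ * s)) + -1ℤ * (α * β - (a * b - + 1 * s))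
        id = solve-∀
        eq : (a - α) * (b + β) ≡ (k₂ - k + 1ℤ) * s
        eq = combine₃ 1ℤ -1ℤ -1ℤ aβ αb' αβ (id a b α β k k₂ s)
      αb : α * b ≡ X - k * s
      αb = trans αb' (cong (λ x → X - x * s) (≤-antisym k₂≤k k≤k₂))
      s≡u[b-β] : s ≡ u * (b - β)
      s≡u[b-β] = combine₃ 1ℤ -1ℤ 1ℤ aβ αb αβ (id a b α β k s)
        where
        id : ∀ a b α β k s → s - (a + α) * (b - β) ≡
          1ℤ * (a * β - (a * b - k * s)) + -1ℤ * (α * b - (a * b - k * s)) + 1ℤ * (α * β - (a * b - + 1 * s))
        id = solve-∀
      s≡v[a-α] : s ≡ v * (a - α)
      s≡v[a-α] = combine₃ -1ℤ 1ℤ 1ℤ aβ αb αβ (id a b α β k s)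
        where
        id : ∀ a b α β k s → s - (b + β) * (a - α) ≡
          -1ℤ * (a * β - (a * b - k * s)) + 1ℤ * (α * b - (a * b - k * s)) + 1ℤ * (α * β - (a * b - + 1 * s))
        id = solve-∀
      a≡ku : a ≡ k * u
      a≡ku = *-cancelʳ (0<⇒≢0 0<b-β) (combine₂ -1ℤ k aβ s≡u[b-β] (id a b α β k s))
        where
        id : ∀ a b α β k s → a * (b - β) - k * (a + α) * (b - β) ≡
          -1ℤ * (a * β - (a * b - k * s)) + k * (s - (a + α) * (b - β))
        id = solve-∀
      b≡kv : b ≡ k * v
      b≡kv = *-cancelʳ (0<⇒≢0 0<a-α) (combine₂ -1ℤ k αb s≡v[a-α] (id a b α β k s))
        where
        id : ∀ a b α β k s → b * (a - α) - k * (b + β) * (a - α) ≡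
          -1ℤ * (α * b - (a * b - k * s)) + k * (s - (b + β) * (a - α))
        id = solve-∀
      0<uv : 0ℤ < u * v
      0<uv = 0<* 0<u 0<v
      uv≢0 = 0<⇒≢0 0<uv
      X≡ : X ≡ k * k * (u * v)
      X≡ = trans (cong₂ _*_ a≡ku b≡kv) (id k u v)
        where
        id : ∀ k u v → k * u * (k * v) ≡ k * k * (u * v)
        id = solve-∀
      s≡ : s ≡ (+ 2 * k - 1ℤ) * (u * v)
      s≡ = combine₂ 1ℤ (+ 2 * u) s≡u[b-β] b≡kv (id a α b β k s)
        where
        id : ∀ a α b β k s → s - (+ 2 * k - 1ℤ) * ((a + α) * (b + β)) ≡
          1ℤ * (s - (a + α) * (b - β)) + + 2 * (a + α) * (b - k * (b + β))
        id = solve-∀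
      0<k : 0ℤ < k
      0<k = 0<*⇒0<ˡ 0<u (subst (0ℤ <_) a≡ku 0<a)
      P-two : ∀ i' → P i' ≡ a ⊎ P i' ≡ α
      P-two i' = classify k (index i' j₀) (index i' j) 0<b α<0 0<s 0<k (+≤+ z≤n) αb s≡u[b-β] a≡ku b≡kv
        (index-eq i' j₀) (index-eq i' j) (index-≤ i' j₀)
      R-two : ∀ j' → R j' ≡ b ⊎ R j' ≡ β
      R-two j' = classify {b} {a} {β} {α} k (index i₀ j') (index i j') 0<a β<0 0<s 0<k (+≤+ z≤n)
        (flip-eq a β k aβ) s≡v[a-α] b≡kv a≡ku
        (flip-eq a (R j') (index i₀ j') (index-eq i₀ j')) (flip-eq α (R j') (index i j') (index-eq i j'))
        (subst (λ x → index i₀ j' * s ≤ + 2 * x) (*-comm a b) (index-≤ i₀ j'))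
        where
        flip-eq : ∀ x y k → x * y ≡ a * b - k * s → y * x ≡ b * a - k * s
        flip-eq x y k eq = trans (*-comm y x) (trans eq (cong (_- k * s) (*-comm a b)))
      same-multiple : ∀ x y → X - x * s ≡ X - y * s → x ≡ y
      same-multiple x y eq = *-cancelʳ s≢0 (combine₁ -1ℤ eq (id x y s X))
        where
        id : ∀ x y s X → x * s - y * s ≡ -1ℤ * (X - x * s - (X - y * s))
        id = solve-∀
      conclude : ∀ m → m ℕ.< N → k ≡ + m → N ≡ 3 × + 4 * s ≡ + 3 * X
      conclude 0 _ k≡0 = ⊥-elim (0<⇒≢0 0<k k≡0)
      conclude 1 _ k≡1 = ⊥-elim (0<⇒≢0 {a - u} (subst (0ℤ <_) (id a α) (neg-mono-< α<0)) 
        (trans (cong (_- u) (trans a≡ku (trans (cong (_* u) k≡1) (*-identityˡ u)))) (+-inverseʳ u)))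
        where
        id : ∀ a α → - α ≡ a - (a + α)
        id = solve-∀
      -- With `w = uv` the progression runs `4w, w, -2w, -5w`; its fourth term is below `- X`, where
      -- neither a product nor zero can lie.
      conclude 2 2<N k≡2 = ℕ.≤-antisym (ℕ.≮⇒≥ λ 3<N → no-fourth (AP∈product 3 3<N)) 2<N , 4s≡3X
        where
        id₁ : ∀ w s X → + 4 * s - + 3 * X ≡ + 4 * (s - (+ 2 * + 2 - 1ℤ) * w) + - + 3 * (X - + 2 * + 2 * w)
        id₁ = solve-∀
        s≡3w : s ≡ (+ 2 * + 2 - 1ℤ) * (u * v)
        s≡3w = trans s≡ (cong (λ k → (+ 2 * k - 1ℤ) * (u * v)) k≡2)
        X≡4w : X ≡ + 2 * + 2 * (u * v)
        X≡4w = trans X≡ (cong (λ k → k * k * (u * v)) k≡2)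
        4s≡3X : + 4 * s ≡ + 3 * X
        4s≡3X = combine₂ (+ 4) (- + 3) s≡3w X≡4w (id₁ (u * v) s X)
        id₂ : ∀ w s X → X - + 3 * s - - (X + w) ≡ - + 3 * (s - (+ 2 * + 2 - 1ℤ) * w) + + 2 * (X - + 2 * + 2 * w)
        id₂ = solve-∀
        fourth : X - + 3 * s ≡ - (X + u * v)
        fourth = combine₂ (- + 3) (+ 2) s≡3w X≡4w (id₂ (u * v) s X)
        below : X - + 3 * s < - X
        below = subst₂ _<_ (sym fourth) (cong -_ (+-identityʳ X)) (neg-mono-< (+-monoʳ-< X 0<uv))
        no-fourth : X - + 3 * s ≡ 0ℤ ⊎ (∃ λ i → ∃ λ j → P i * R j ≡ X - + 3 * s) → ⊥
        no-fourth (inj₁ eq) = <-irrefl refl (<-trans (subst (_< - X) eq below) (neg-mono-< 0<X))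
        no-fourth (inj₂ (i' , j' , eq)) = <-irrefl refl (≤-<-trans (-X≤product i' j') (subst (_< - X) (sym eq) below))
      -- For `k = n + 3` the third term is `(n² + 2n - 1)uv`, which is not zero. Nor is it a
      -- product, because `P-two` and `R-two` confine the products to the terms of index `0`, `1`
      -- and `k`.
      conclude (suc (suc (suc n))) k<N k≡ = ⊥-elim (no-third (AP∈product 2 (ℕ.≤-trans (s≤s (s≤s (s≤s z≤n))) (ℕ.<⇒≤ k<N))))
        where
        k≢2 : k ≢ + 2
        k≢2 k≡2 with () ← trans (sym k≡) k≡2
        id : ∀ n w s X → (n * n + + 2 * n - 1ℤ) * w - (X - + 2 * s) ≡
          -1ℤ * (X - (+ 3 + n) * (+ 3 + n) * w) + + 2 * (s - (+ 2 * (+ 3 + n) - 1ℤ) * w)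
        id = solve-∀
        k≡3+n : k ≡ + 3 + + n
        k≡3+n = k≡
        third : (+ n * + n + + 2 * + n - 1ℤ) * (u * v) ≡ X - + 2 * s
        third = combine₂ -1ℤ (+ 2) (trans X≡ (cong (λ k → k * k * (u * v)) k≡3+n))
          (trans s≡ (cong (λ k → (+ 2 * k - 1ℤ) * (u * v)) k≡3+n)) (id (+ n) (u * v) s X)
        X-0s≡X : ∀ X s → X - + 0 * s ≡ X
        X-0s≡X = solve-∀
        no-third : X - + 2 * s ≡ 0ℤ ⊎ (∃ λ i → ∃ λ j → P i * R j ≡ X - + 2 * s) → ⊥
        no-third (inj₁ eq) = *-≢0 (n²+2n≢1 n) uv≢0 (trans third eq)
        no-third (inj₂ (i' , j' , eq)) = four-cases (P-two i') (R-two j')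
          where
          four-cases : P i' ≡ a ⊎ P i' ≡ α → R j' ≡ b ⊎ R j' ≡ β → ⊥
          four-cases (inj₁ P≡) (inj₁ R≡) with () ← same-multiple (+ 0) (+ 2) (trans (trans (X-0s≡X X s) (sym (cong₂ _*_ P≡ R≡))) eq)
          four-cases (inj₁ P≡) (inj₂ R≡) = k≢2 (same-multiple k (+ 2) (trans (sym aβ) (trans (sym (cong₂ _*_ P≡ R≡)) eq)))
          four-cases (inj₂ P≡) (inj₁ R≡) = k≢2 (same-multiple k (+ 2) (trans (sym αb) (trans (sym (cong₂ _*_ P≡ R≡)) eq)))
          four-cases (inj₂ P≡) (inj₂ R≡) with () ← same-multiple (+ 1) (+ 2) (trans (sym αβ) (trans (sym (cong₂ _*_ P≡ R≡)) eq))

    1*s≡s : + 1 * s ≡ s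
    1*s≡s = *-identityˡ s

    P≡a : ∀ i → P i * b ≡ X → P i ≡ a
    P≡a i = *-cancelʳ (0<⇒≢0 0<b)

    P≡-a : ∀ i → P i * b ≡ - X → P i ≡ - a
    P≡-a i eq = *-cancelʳ (0<⇒≢0 0<b) (trans eq (neg-distribˡ-* a b))

    -- No product is below `- X`, so only `X` and `X - s` occur. The non-maximal factors give
    -- `(P i₁ * R j₁)X = (X - s)²`, which for `0 < X < s` is possible only if `P i₁ * R j₁ = X` and
    -- `s = 2X`; the second value is then `- X`.
    step-exceeds-X : X < s → (∃ λ i → P i ≢ a) → (∃ λ j → R j ≢ b) → ∀ i → P i ≡ a ⊎ P i ≡ - a
    step-exceeds-X X<s (i₁ , P≢a) (j₁ , R≢b) i = from (two-values i j₀)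
      where
      two-values : ∀ i j → P i * R j ≡ X ⊎ P i * R j ≡ X - s
      two-values i j with product∈AP i j | index-≤ i j
      ... | 0 , _ , eq | _ = inj₁ (trans eq (+-identityʳ X))
      ... | 1 , _ , eq | _ = inj₂ (trans eq (cong (λ x → X - x) 1*s≡s))
      ... | suc (suc m) , _ , _ | m≤ = ⊥-elim (ℕ.<⇒≱ (drop‿+<+ (*-cancelʳ-< {+ suc (suc m)} {+ 2} 0<s
          (≤-<-trans m≤ (*-monoˡ-<-pos (+ 2) X<s)))) (s≤s (s≤s z≤n)))
      αb≡ : P i₁ * b ≡ X - s
      αb≡ with two-values i₁ j₀
      ... | inj₁ eq = ⊥-elim (P≢a (P≡a i₁ eq))
      ... | inj₂ eq = eq
      aβ≡ : a * R j₁ ≡ X - s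
      aβ≡ with two-values i₀ j₁
      ... | inj₁ eq = ⊥-elim (R≢b (*-cancelˡ (0<⇒≢0 0<a) eq))
      ... | inj₂ eq = eq
      s≡2X : P i₁ * R j₁ ≡ X ⊎ P i₁ * R j₁ ≡ X - s → s ≡ + 2 * X
      s≡2X (inj₁ eq) = *-cancelʳ s≢0 (combine₃ (- (a * R j₁)) (- (X - s)) X
          αb≡ aβ≡ eq (id a b (P i₁) (R j₁) s))
        where
        id : ∀ a b α β s → s * s - + 2 * (a * b) * s ≡
          - (a * β) * (α * b - (a * b - s)) + - (a * b - s) * (a * β - (a * b - s)) + a * b * (α * β - a * b)
        id = solve-∀
      s≡2X (inj₂ eq) = ⊥-elim (*-≢0 s≢0 (λ X-s≡0 → <-irrefl (i-j≡0⇒i≡j X s X-s≡0) X<s)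
        (combine₃ (a * R j₁) (X - s) (- X) αb≡ aβ≡ eq (id a b (P i₁) (R j₁) s)))
        where
        id : ∀ a b α β s → s * (a * b - s) - 0ℤ ≡
          a * β * (α * b - (a * b - s)) + (a * b - s) * (a * β - (a * b - s)) + - (a * b) * (α * β - (a * b - s))
        id = solve-∀
      from : P i * b ≡ X ⊎ P i * b ≡ X - s → P i ≡ a ⊎ P i ≡ - a
      from (inj₁ eq) = inj₁ (P≡a i eq)
      from (inj₂ eq) = inj₂ (P≡-a i (combine₂ 1ℤ -1ℤ eq (s≡2X (two-values i₁ j₁)) (id (P i) b X s)))
        where
        id : ∀ α b X s → α * b - - X ≡ 1ℤ * (α * b - (X - s)) + -1ℤ * (s - + 2 * X)
        id = solve-∀

    -- The candidates are `X`, `0` and `- X`, and a product is never zero.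
    step-equals-X : s ≡ X → ∀ i → P i ≡ a ⊎ P i ≡ - a
    step-equals-X s≡X i with product∈AP i j₀ | index-≤ i j₀
    ... | 0 , _ , eq | _ = inj₁ (P≡a i (trans eq (+-identityʳ X)))
    ... | 1 , _ , eq | _ = ⊥-elim (*-≢0 (P≢0 i) (R≢0 j₀)
      (trans eq (trans (cong (λ x → X - x) (trans 1*s≡s s≡X)) (+-inverseʳ X))))
    ... | 2 , _ , eq | _ = inj₂ (P≡-a i (trans eq (trans (cong (λ x → X - + 2 * x) s≡X) (id X))))
      where
      id : ∀ X → X - + 2 * X ≡ - X
      id = solve-∀
    ... | suc (suc (suc m)) , _ , _ | m≤ = ⊥-elim (ℕ.<⇒≱ (s≤s (s≤s (s≤s z≤n)))
      (drop‿+≤+ (*-cancelʳ-≤ {+ suc (suc (suc m))} {+ 2} 0<s (subst (λ x → + suc (suc (suc m)) * s ≤ + 2 * x) (sym s≡X) m≤))))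

    -- The second term `X - s` is positive, so its factors have the same sign. If both are positive,
    -- one is maximal: `P i ≢ a` pushes `P i * b` down to at most `X - s = P i * R j`, whence
    -- `R j ≡ b`. If both are negative, one is `- a` or `- b`, or else `both-negative` applies.
    step-below-X : s < X → (∀ m → m ℕ.< N → X - + m * s ≡ 0ℤ ⊎ ∃ λ i → ∃ λ j → P i * R j ≡ X - + m * s) →
      ∀ i j → P i * R j ≡ X - + 1 * s → Conclusion
    step-below-X s<X AP∈product i j αβ = cases (<-cmp 0ℤ (P i))
      where
      0<αβ : 0ℤ < P i * R j
      0<αβ = subst (0ℤ <_) (sym (trans αβ (cong (λ x → X - x) 1*s≡s))) (subst (_< X - s) (+-inverseʳ s) (+-monoˡ-< (- s) s<X))
      β<0 : P i < 0ℤ → R j < 0ℤ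
      β<0 α<0 = subst (_< 0ℤ) (neg-involutive (R j)) (neg-mono-< (0<*⇒0<ˡ (neg-mono-< α<0)
        (subst (0ℤ <_) (id (P i) (R j)) 0<αβ)))
        where
        id : ∀ α β → α * β ≡ - β * - α
        id = solve-∀
      positive-case : 0ℤ < P i → P i ≢ a → ∀ j' → R j' ≡ b ⊎ R j' ≡ - b
      positive-case 0<α α≢a = R-from-gap i (combine₂ 1ℤ (- P i) αβ β≡b (id a b (P i) (R j) s))
        where
        id : ∀ a b α β s → s - b * (a - α) ≡ 1ℤ * (α * β - (a * b - + 1 * s)) + - α * (β - b)
        id = solve-∀
        αb≤X-s : P i * b ≤ X - + 1 * s
        αb≤X-s with product∈AP i j₀
        ... | 0 , _ , eq = ⊥-elim (α≢a (P≡a i (trans eq (+-identityʳ X))))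
        ... | suc m , _ , eq = subst (_≤ X - + 1 * s) (sym eq)
          (+-monoʳ-≤ X (neg-mono-≤ (*-monoʳ-≤-nonNeg s {{nonNegative (<⇒≤ 0<s)}} (+≤+ {1} {suc m} (s≤s z≤n)))))
        b≤β : b ≤ R j
        b≤β = *-cancelʳ-≤ 0<α (subst₂ _≤_ (*-comm (P i) b) (trans (sym αβ) (*-comm (P i) (R j))) αb≤X-s)
        β≡b : R j ≡ b
        β≡b = ≤-antisym (R≤b j) b≤β
      0<sum : ∀ {x y} → - x ≤ y → y ≢ - x → 0ℤ < x + y
      0<sum {x} {y} -x≤y y≢-x = subst (_< x + y) (+-inverseʳ x) (+-monoʳ-< x (≤∧≢⇒< -x≤y (λ e → y≢-x (sym e))))
      negative-case : P i < 0ℤ → R j < 0ℤ → Conclusion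
      negative-case α<0 β<0 with P i ≟ - a | R j ≟ - b
      ... | yes α≡-a | _ = inj₁ (P-from-sum i j α≡-a (combine₂ 1ℤ (- R j) αβ α≡-a (id a b (P i) (R j) s)))
        where
        id : ∀ a b α β s → s - a * (b + β) ≡ 1ℤ * (α * β - (a * b - + 1 * s)) + - β * (α - - a)
        id = solve-∀
      ... | no _ | yes β≡-b = inj₂ (inj₁ (R-from-sum i j β≡-b (combine₂ 1ℤ (- P i) αβ β≡-b (id a b (P i) (R j) s))))
        where
        id : ∀ a b α β s → s - b * (a + α) ≡ 1ℤ * (α * β - (a * b - + 1 * s)) + - α * (β - - b)
        id = solve-∀
      ... | no α≢-a | no β≢-b = inj₂ (inj₂ (both-negative AP∈product i j α<0 β<0
        (0<sum (-a≤P i) α≢-a) (0<sum (-b≤R j) β≢-b) αβ))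
      cases : Tri (0ℤ < P i) (0ℤ ≡ P i) (0ℤ > P i) → Conclusion
      cases (tri≈ _ 0≡α _) = ⊥-elim (P≢0 i (sym 0≡α))
      cases (tri> _ _ α<0) = negative-case α<0 (β<0 α<0)
      cases (tri< 0<α _ _) with P i ≟ a
      ... | yes α≡a = inj₁ (P-from-gap j (combine₂ 1ℤ (- R j) αβ α≡a (id a b (P i) (R j) s)))
        where
        id : ∀ a b α β s → s - a * (b - β) ≡ 1ℤ * (α * β - (a * b - + 1 * s)) + - β * (α - a)
        id = solve-∀
      ... | no α≢a = inj₂ (inj₁ (positive-case 0<α α≢a))

  extremal : 2 ℕ.≤ N → (∃ λ i → P i ≢ a) → (∃ λ j → R j ≢ b) →
    (∀ m → m ℕ.< N → X - + m * s ≡ 0ℤ ⊎ ∃ λ i → ∃ λ j → P i * R j ≡ X - + m * s) → Conclusion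
  extremal 2≤N ∃i ∃j AP∈product with <-cmp s X
  ... | tri> _ _ X<s = inj₁ (step-exceeds-X X<s ∃i ∃j)
  ... | tri≈ _ s≡X _ = inj₁ (step-equals-X s≡X)
  ... | tri< s<X s≢X _ with AP∈product 1 2≤N
  ...   | inj₁ eq = ⊥-elim (s≢X (trans (sym 1*s≡s) (sym (i-j≡0⇒i≡j X (+ 1 * s) eq))))
  ...   | inj₂ (i , j , eq) = step-below-X s<X AP∈product i j eq

-- Finite sums of integers

∣m-n∣<k : ∀ {m n k} → m ℕ.< k → n ℕ.< k → ∣ + m - + n ∣ ℕ.< k
∣m-n∣<k {m} {n} m<k n<k = ℕ.≤-<-trans
  (subst (ℕ._≤ m ℕ.⊔ n) (cong ∣_∣ (sym (m-n≡m⊖n m n))) (∣m⊝n∣≤m⊔n m n)) (ℕ.⊔-lub m<k n<k)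

sum-mono : ∀ {n} {f g : Fin n → ℤ} → (∀ i → f i ≤ g i) → sum f ≤ sum g
sum-mono {zero}  f≤g = ≤-refl
sum-mono {suc n} f≤g = +-mono-≤ (f≤g zero) (sum-mono (f≤g ∘ suc))

sum-const : ∀ n c → sum {n} (λ _ → c) ≡ + n * c
sum-const zero    c = sym (*-zeroˡ c)
sum-const (suc n) c = trans (cong (λ t → c + t) (sum-const n c)) (sym (suc-* (+ n) c))

sum-nonneg : ∀ {n} {f : Fin n → ℤ} → (∀ i → 0ℤ ≤ f i) → 0ℤ ≤ sum f
sum-nonneg {n} {f} 0≤f = subst (_≤ sum f) (trans (sum-const n 0ℤ) (*-zeroʳ (+ n))) (sum-mono 0≤f)

sum-single : ∀ {n} {f : Fin n → ℤ} i → (∀ j → j ≢ i → f j ≡ 0ℤ) → sum f ≡ f i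
sum-single {suc n} {f} i f≡0 = begin
  sum f                                ≡⟨ sum-remove {i = i} f ⟩
  f i + sum (λ j → f (punchIn i j))    ≡⟨ cong (λ t → f i + t) (sum-cong-≗ (λ j → f≡0 (punchIn i j) (punchInᵢ≢i i j))) ⟩
  f i + sum {n} (λ _ → 0ℤ)             ≡⟨ cong (λ t → f i + t) (trans (sum-const n 0ℤ) (*-zeroʳ (+ n))) ⟩
  f i + 0ℤ                             ≡⟨ +-identityʳ (f i) ⟩
  f i                                  ∎
  where open ≡-Reasoning

module _ {m n : ℕ} (h : Fin (suc m) → Fin (suc n)) (h-injective : Injective _≡_ _≡_ h) where

  h-zero≢ : ∀ i → h zero ≢ h (suc i)
  h-zero≢ i eq with () ← h-injective eq

  -- Deleting `h zero` from the codomain leaves an injection of the remaining indices, which is the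
  -- induction step of both reindexing lemmas below.
  punched : Fin m → Fin n
  punched i = punchOut (h-zero≢ i)

  punched-injective : Injective _≡_ _≡_ punched
  punched-injective {i} {j} eq = sucᶠ-injective (h-injective (punchOut-injective (h-zero≢ i) (h-zero≢ j) eq))

  sum-punched : (g : Fin (suc n) → ℤ) →
    sum (λ i → g (h i)) ≡ g (h zero) + sum (λ i → g (punchIn (h zero) (punched i)))
  sum-punched g = cong (λ t → g (h zero) + t) (sum-cong-≗ (λ i → cong g (sym (punchIn-punchOut (h-zero≢ i)))))

sum-injective-≤ : ∀ {m n} (h : Fin m → Fin n) → Injective _≡_ _≡_ h → (g : Fin n → ℤ) → (∀ x → 0ℤ ≤ g x) →
  sum (λ i → g (h i)) ≤ sum g
sum-injective-≤ {zero}  h h-inj g 0≤g = sum-nonneg 0≤g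
sum-injective-≤ {suc m} {zero}  h h-inj g 0≤g with () ← h zero
sum-injective-≤ {suc m} {suc n} h h-inj g 0≤g = subst₂ _≤_ (sym (sum-punched h h-inj g)) (sym (sum-remove {i = h zero} g))
  (+-monoʳ-≤ (g (h zero)) (sum-injective-≤ (punched h h-inj) (punched-injective h h-inj) (g ∘ punchIn (h zero)) (λ x → 0≤g _)))

sum-reindex : ∀ {n} (h : Fin n → Fin n) → Injective _≡_ _≡_ h → (g : Fin n → ℤ) → sum (λ i → g (h i)) ≡ sum g
sum-reindex {zero}  h h-inj g = refl
sum-reindex {suc n} h h-inj g = trans (sum-punched h h-inj g) (trans
  (cong (λ t → g (h zero) + t) (sum-reindex (punched h h-inj) (punched-injective h h-inj) (g ∘ punchIn (h zero))))
  (sym (sum-remove {i = h zero} g)))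

sum-step : ∀ n L x y → L ℕ.≤ n →
  sum {n} (λ i → if toℕ i ℕ.<ᵇ L then x else y) ≡ + L * x + (+ n - + L) * y
sum-step n zero x y _ = trans (sum-const n y) (id (+ n) x y)
  where
  id : ∀ n x y → n * y ≡ + 0 * x + (n - + 0) * y
  id = solve-∀
sum-step (suc n) (suc L) x y (s≤s L≤n) = trans (cong (λ t → x + t) (sum-step n L x y L≤n)) (id (+ n) (+ L) x y)
  where
  id : ∀ n L x y → x + (L * x + (n - L) * y) ≡ (+ 1 + L) * x + (+ 1 + n - (+ 1 + L)) * y
  id = solve-∀

-- Congruences and the sieve

module Modular (p : ℕ) .{{_ : NonZero p}} where

  infix 4 _≈_

  record _≈_ (x y : ℤ) : Set where
    constructor congruent
    field divides : (+ p) Signed.∣ (x - y)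

  private
    scaled : ∀ {x y} c → x ≈ y → (+ p) Signed.∣ c * (x - y)
    scaled c (congruent d) = Signed.∣n⇒∣m*n c d

  ≈-combine₁ : ∀ {g h x y} c → x ≈ y → g - h ≡ c * (x - y) → g ≈ h
  ≈-combine₁ c e eq = congruent (subst ((+ p) Signed.∣_) (sym eq) (scaled c e))

  ≈-combine₂ : ∀ {g h x y x' y'} c c' → x ≈ y → x' ≈ y' → g - h ≡ c * (x - y) + c' * (x' - y') → g ≈ h
  ≈-combine₂ c c' e e' eq = congruent (subst ((+ p) Signed.∣_) (sym eq) (Signed.∣m∣n⇒∣m+n (scaled c e) (scaled c' e')))

  ≈-combine₃ : ∀ {g h x y x' y' x″ y″} c c' c″ → x ≈ y → x' ≈ y' → x″ ≈ y″ →
    g - h ≡ c * (x - y) + c' * (x' - y') + c″ * (x″ - y″) → g ≈ h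
  ≈-combine₃ c c' c″ e e' e″ eq = congruent (subst ((+ p) Signed.∣_) (sym eq)
    (Signed.∣m∣n⇒∣m+n (Signed.∣m∣n⇒∣m+n (scaled c e) (scaled c' e')) (scaled c″ e″)))

  ≡⇒≈ : ∀ {x y} → x ≡ y → x ≈ y
  ≡⇒≈ {x} refl = congruent (Signed.divides 0ℤ (trans (+-inverseʳ x) (sym (*-zeroˡ (+ p)))))

  ≈-refl : ∀ {x} → x ≈ x
  ≈-refl = ≡⇒≈ refl

  ≈-sym : ∀ {x y} → x ≈ y → y ≈ x
  ≈-sym {x} {y} e = ≈-combine₁ -1ℤ e (id x y)
    where
    id : ∀ x y → y - x ≡ -1ℤ * (x - y)
    id = solve-∀

  ≈-trans : ∀ {x y z} → x ≈ y → y ≈ z → x ≈ z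
  ≈-trans {x} {y} {z} e e' = ≈-combine₂ 1ℤ 1ℤ e e' (id x y z)
    where
    id : ∀ x y z → x - z ≡ 1ℤ * (x - y) + 1ℤ * (y - z)
    id = solve-∀

  ≈⇒≡ : ∀ {x y} → x ≈ y → ∣ x - y ∣ ℕ.< p → x ≡ y
  ≈⇒≡ {x} {y} (congruent d) small with ∣ x - y ∣ in eq | Signed.∣⇒∣ᵤ d
  ... | zero  | _ = i-j≡0⇒i≡j x y (∣i∣≡0⇒i≡0 eq)
  ... | suc m | p∣m = ⊥-elim (ℕ.>⇒∤ small p∣m)

  ⟦_⟧ : Fin p → ℤ
  ⟦ x ⟧ = + toℕ x

  res : ℤ → Fin p
  res z = fromℕ< (n%ℕd<d z p)

  ⟦res⟧ : ∀ z → ⟦ res z ⟧ ≈ z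
  ⟦res⟧ z = congruent (Signed.divides (- (z /ℕ p)) (begin
    ⟦ res z ⟧ - z                                   ≡⟨ cong (λ k → + k - z) (toℕ-fromℕ< (n%ℕd<d z p)) ⟩
    + (z %ℕ p) - z                                  ≡⟨ cong (λ t → + (z %ℕ p) - t) (a≡a%ℕn+[a/ℕn]*n z p) ⟩
    + (z %ℕ p) - (+ (z %ℕ p) + (z /ℕ p) * + p)      ≡⟨ id (+ (z %ℕ p)) (z /ℕ p) (+ p) ⟩
    - (z /ℕ p) * + p ∎))
    where
    open ≡-Reasoning
    id : ∀ r q p → r - (r + q * p) ≡ - q * p
    id = solve-∀

  ⟦⟧-injective : ∀ {x y} → ⟦ x ⟧ ≈ ⟦ y ⟧ → x ≡ y
  ⟦⟧-injective {x} {y} e = toℕ-injective (+-injective (≈⇒≡ e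
    (∣m-n∣<k (toℕ<n x) (toℕ<n y))))

  res-cong : ∀ {x y} → x ≈ y → res x ≡ res y
  res-cong {x} {y} e = ⟦⟧-injective (≈-trans (⟦res⟧ x) (≈-trans e (≈-sym (⟦res⟧ y))))

  res-⟦⟧ : ∀ x → res ⟦ x ⟧ ≡ x
  res-⟦⟧ x = ⟦⟧-injective (⟦res⟧ ⟦ x ⟧)

  ⟦[]⟧ : ∀ k → ⟦ [_] p k ⟧ ≈ + k
  ⟦[]⟧ k = congruent (Signed.divides (- + (k ℕ./ p)) (begin
    ⟦ [_] p k ⟧ - + k                                   ≡⟨ cong₂ (λ r k → + r - k) (toℕ-fromℕ< (ℕ.m%n<n k p)) (a≡a%ℕn+[a/ℕn]*n (+ k) p) ⟩
    + (k ℕ.% p) - (+ (k ℕ.% p) + + (k ℕ./ p) * + p)     ≡⟨ id (+ (k ℕ.% p)) (+ (k ℕ./ p)) (+ p) ⟩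
    - + (k ℕ./ p) * + p ∎))
    where
    open ≡-Reasoning
    id : ∀ r q p → r - (r + q * p) ≡ - q * p
    id = solve-∀

  Periodic : (ℤ → ℤ) → Set
  Periodic G = ∀ {x y} → x ≈ y → G x ≡ G y

  module Field (p-prime : Prime p) where

    *≈0 : ∀ x y → x * y ≈ 0ℤ → x ≈ 0ℤ ⊎ y ≈ 0ℤ
    *≈0 x y (congruent d) = Sum.map from from
      (euclidsLemma (∣ x ∣) (∣ y ∣) p-prime (subst (p ℕ.∣_) (abs-* x y) (Signed.∣⇒∣ᵤ (subst ((+ p) Signed.∣_) (+-identityʳ (x * y)) d))))
      where
      from : ∀ {z} → p ℕ.∣ ∣ z ∣ → z ≈ 0ℤ
      from {z} p∣z = congruent (subst ((+ p) Signed.∣_) (sym (+-identityʳ z)) (Signed.∣ᵤ⇒∣ p∣z))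

    ≈-cancelˡ : ∀ {x y z} → ¬ x ≈ 0ℤ → x * y ≈ x * z → y ≈ z
    ≈-cancelˡ {x} {y} {z} x≉0 e = Sum.[ ⊥-elim ∘ x≉0 , (λ e' → ≈-combine₁ 1ℤ e' (id₂ y z)) ]
      (*≈0 x (y - z) (≈-combine₁ 1ℤ e (id₁ x y z)))
      where
      id₁ : ∀ x y z → x * (y - z) - 0ℤ ≡ 1ℤ * (x * y - x * z)
      id₁ = solve-∀
      id₂ : ∀ y z → y - z ≡ 1ℤ * (y - z - 0ℤ)
      id₂ = solve-∀

    sum-affine : ∀ {G} → Periodic G → ∀ u v → ¬ u ≈ 0ℤ →
      sum (λ x → G (u * ⟦ x ⟧ + v)) ≡ sum (λ x → G ⟦ x ⟧)
    sum-affine {G} G-periodic u v u≉0 = trans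
      (sum-cong-≗ (λ x → G-periodic (≈-sym (⟦res⟧ (u * ⟦ x ⟧ + v)))))
      (sum-reindex (λ x → res (u * ⟦ x ⟧ + v)) inj (λ x → G ⟦ x ⟧))
      where
      inj : Injective _≡_ _≡_ (λ x → res (u * ⟦ x ⟧ + v))
      inj {x} {y} eq = ⟦⟧-injective (≈-cancelˡ u≉0 (≈-combine₃ 1ℤ 1ℤ 1ℤ
        (≈-sym (⟦res⟧ (u * ⟦ x ⟧ + v))) (≡⇒≈ (cong ⟦_⟧ eq)) (⟦res⟧ (u * ⟦ y ⟧ + v))
        (id u v ⟦ x ⟧ ⟦ y ⟧ ⟦ res (u * ⟦ x ⟧ + v) ⟧ ⟦ res (u * ⟦ y ⟧ + v) ⟧)))
        where
        id : ∀ u v x y r r' → u * x - u * y ≡ 1ℤ * (u * x + v - r) + 1ℤ * (r - r') + 1ℤ * (r' - (u * y + v))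
        id = solve-∀

    module Sieve {s m W : ℕ} (X : Fin s → ℤ) (Y : Fin m → ℤ) (z₀ : ℤ)
      (X-injective : ∀ {i j} → X i ≈ X j → i ≡ j) (Y-injective : ∀ {i j} → Y i ≈ Y j → i ≡ j)
      (0<s : 0 ℕ.< s) (0<W : 0 ℕ.< W) (4W≤p : 4 ℕ.* W ℕ.≤ p)
      (small : ∀ i j → ∃ λ c → c ℕ.< W × X i * Y j ≈ z₀ + + c)
      where

      private
        L : ℕ
        -- Twice the window, so that each slope `Y j` has `W` shifts keeping every point inside;
        -- `4W ≤ p` still gives `d ≥ p/2`.
        L = W ℕ.+ W

        d : ℤ
        d = + p - + L

        ψ : Fin p → ℤ
        ψ x = if toℕ x ℕ.<ᵇ L then d else - + L

        -- p times the indicator of z₀ + {0, …, L - 1}, minus its mean value L.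
        φ : ℤ → ℤ
        φ z = ψ (res (z - z₀))

        φ-periodic : Periodic φ
        φ-periodic {x} {y} e = cong ψ (res-cong {x - z₀} {y - z₀} (≈-combine₁ 1ℤ e (id x y z₀)))
          where
          id : ∀ x y z → x - z - (y - z) ≡ 1ℤ * (x - y)
          id = solve-∀

        4W≡ : 4 ℕ.* W ≡ L ℕ.+ L
        4W≡ = trans (cong (λ t → W ℕ.+ (W ℕ.+ (W ℕ.+ t))) (ℕ.+-identityʳ W)) (sym (ℕ.+-assoc W W L))

        2L≤p : L ℕ.+ L ℕ.≤ p
        2L≤p = subst (ℕ._≤ p) 4W≡ 4W≤p

        L≤p : L ℕ.≤ p
        L≤p = ℕ.≤-trans (ℕ.m≤m+n L L) 2L≤p

        W≤L : W ℕ.≤ L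
        W≤L = ℕ.m≤m+n W W

        1≉0 : ¬ 1ℤ ≈ 0ℤ
        1≉0 e with () ← ≈⇒≡ e (ℕ.<-≤-trans (ℕ.<-≤-trans (s≤s (s≤s z≤n)) (ℕ.+-mono-≤ 0<W 0<W)) L≤p)

        sum-φ : ∀ (g : ℤ → ℤ) u v → ¬ u ≈ 0ℤ → sum (λ x → g (φ (u * ⟦ x ⟧ + v))) ≡ sum (λ x → g (ψ x))
        sum-φ g u v u≉0 = trans
          (sum-cong-≗ (λ x → cong (λ z → g (ψ (res z))) (+-assoc (u * ⟦ x ⟧) v (- z₀))))
          (trans (sum-affine (λ e → cong (λ x → g (ψ x)) (res-cong e)) u (v - z₀) u≉0)
            (sum-cong-≗ (λ x → cong (λ y → g (ψ y)) (res-⟦⟧ x))))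

        sum-ψ : sum ψ ≡ 0ℤ
        sum-ψ = trans (sum-step p L d (- + L) L≤p) (id (+ L) (+ p))
          where
          id : ∀ L p → L * (p - L) + (p - L) * - L ≡ 0ℤ
          id = solve-∀

        sum-ψ² : sum (λ x → ψ x * ψ x) ≡ + L * d * + p
        sum-ψ² = trans (sum-cong-≗ square) (trans (sum-step p L (d * d) (- + L * - + L) L≤p) (id (+ L) (+ p)))
          where
          square : ∀ x → ψ x * ψ x ≡ (if toℕ x ℕ.<ᵇ L then d * d else - + L * - + L)
          square x with toℕ x ℕ.<ᵇ L
          ... | true  = refl
          ... | false = refl
          id : ∀ L p → L * ((p - L) * (p - L)) + (p - L) * (- L * - L) ≡ L * (p - L) * p
          id = solve-∀

        term : Fin p → Fin p → Fin s → ℤ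
        term y w i = φ (⟦ y ⟧ * X i + ⟦ w ⟧)

        incidence : Fin p → Fin p → ℤ
        incidence y w = sum (term y w)

        correlation : Fin s → Fin s → ℤ
        correlation i j = sum (λ y → sum (λ w → term y w i * term y w j))

        correlation-diagonal : ∀ i → correlation i i ≡ + p * (+ L * d * + p)
        correlation-diagonal i = trans (sum-cong-≗ (λ y → trans
            (sum-cong-≗ (λ w → cong (λ z → φ z * φ z) (id (⟦ y ⟧ * X i) ⟦ w ⟧)))
            (trans (sum-φ (λ z → z * z) 1ℤ (⟦ y ⟧ * X i) 1≉0) sum-ψ²)))
          (sum-const p _)
          where
          id : ∀ t w → t + w ≡ 1ℤ * w + t
          id = solve-∀

        -- Shifting `w` by `y * X i` makes one factor independent of `y`. For fixed `w` the argument
        -- of the other, `δ * y + w`, runs through all residues because `δ` is invertible, and `φ`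
        -- has mean zero.
        correlation-off-diagonal : ∀ i j → j ≢ i → correlation i j ≡ 0ℤ
        correlation-off-diagonal i j j≢i = begin
          sum (λ y → sum (λ w → term y w i * term y w j))
            ≡⟨ sum-cong-≗ shift ⟩
          sum (λ y → sum (λ w → φ ⟦ w ⟧ * φ (δ * ⟦ y ⟧ + ⟦ w ⟧)))
            ≡⟨ ∑-comm (λ y w → φ ⟦ w ⟧ * φ (δ * ⟦ y ⟧ + ⟦ w ⟧)) ⟩
          sum (λ w → sum (λ y → φ ⟦ w ⟧ * φ (δ * ⟦ y ⟧ + ⟦ w ⟧)))
            ≡⟨ sum-cong-≗ (λ w → sym (*-distribˡ-sum (φ ⟦ w ⟧) (λ y → φ (δ * ⟦ y ⟧ + ⟦ w ⟧)))) ⟩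
          sum (λ w → φ ⟦ w ⟧ * sum (λ y → φ (δ * ⟦ y ⟧ + ⟦ w ⟧)))
            ≡⟨ sum-cong-≗ (λ w → trans (cong (φ ⟦ w ⟧ *_) (trans (sum-φ (λ z → z) δ ⟦ w ⟧ δ≉0) sum-ψ)) (*-zeroʳ (φ ⟦ w ⟧))) ⟩
          sum {p} (λ _ → 0ℤ)
            ≡⟨ trans (sum-const p 0ℤ) (*-zeroʳ (+ p)) ⟩
          0ℤ ∎
          where
          open ≡-Reasoning
          δ : ℤ
          δ = X j - X i
          δ≉0 : ¬ δ ≈ 0ℤ
          δ≉0 e = j≢i (X-injective (≈-combine₁ 1ℤ e (id (X j) (X i))))
            where
            id : ∀ x y → x - y ≡ 1ℤ * (x - y - 0ℤ)
            id = solve-∀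
          shift : ∀ y → sum (λ w → term y w i * term y w j) ≡ sum (λ w → φ ⟦ w ⟧ * φ (δ * ⟦ y ⟧ + ⟦ w ⟧))
          shift y = trans
            (sum-cong-≗ (λ w → cong₂ (λ z z' → φ z * φ z') (id₁ ⟦ y ⟧ (X i) ⟦ w ⟧) (id₂ ⟦ y ⟧ (X i) (X j) ⟦ w ⟧)))
            (sum-affine {λ z → φ z * φ (δ * ⟦ y ⟧ + z)}
              (λ {z} {z'} e → cong₂ _*_ (φ-periodic e) (φ-periodic {δ * ⟦ y ⟧ + z} {δ * ⟦ y ⟧ + z'} (≈-combine₁ 1ℤ e (id₃ (δ * ⟦ y ⟧) z z'))))
              1ℤ (⟦ y ⟧ * X i) 1≉0)
            where
            id₁ : ∀ y x w → y * x + w ≡ 1ℤ * w + y * x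
            id₁ = solve-∀
            id₂ : ∀ y x x' w → y * x' + w ≡ (x' - x) * y + (1ℤ * w + y * x)
            id₂ = solve-∀
            id₃ : ∀ t z z' → t + z - (t + z') ≡ 1ℤ * (z - z')
            id₃ = solve-∀

        -- Squaring out and exchanging sums leaves the correlations, of which only the `s` diagonal
        -- ones survive.
        second-moment : sum (λ y → sum (λ w → incidence y w * incidence y w)) ≡ + s * (+ p * (+ L * d * + p))
        second-moment = begin
          sum (λ y → sum (λ w → incidence y w * incidence y w))
            ≡⟨ sum-cong-≗ (λ y → sum-cong-≗ (λ w → expand y w)) ⟩
          sum (λ y → sum (λ w → sum (λ i → sum (λ j → term y w i * term y w j))))
            ≡⟨ sum-cong-≗ (λ y → ∑-comm (λ w i → sum (λ j → term y w i * term y w j))) ⟩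
          sum (λ y → sum (λ i → sum (λ w → sum (λ j → term y w i * term y w j))))
            ≡⟨ ∑-comm (λ y i → sum (λ w → sum (λ j → term y w i * term y w j))) ⟩
          sum (λ i → sum (λ y → sum (λ w → sum (λ j → term y w i * term y w j))))
            ≡⟨ sum-cong-≗ (λ i → trans
                 (sum-cong-≗ (λ y → ∑-comm (λ w j → term y w i * term y w j)))
                 (∑-comm (λ y j → sum (λ w → term y w i * term y w j)))) ⟩
          sum (λ i → sum (λ j → correlation i j))
            ≡⟨ sum-cong-≗ (λ i → trans (sum-single i (correlation-off-diagonal i)) (correlation-diagonal i)) ⟩
          sum {s} (λ _ → + p * (+ L * d * + p))
            ≡⟨ sum-const s _ ⟩
          + s * (+ p * (+ L * d * + p)) ∎
          where
          open ≡-Reasoning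
          expand : ∀ y w → incidence y w * incidence y w ≡ sum (λ i → sum (λ j → term y w i * term y w j))
          expand y w = trans (*-distribʳ-sum (incidence y w) (term y w))
            (sum-cong-≗ (λ i → *-distribˡ-sum (term y w i) (term y w)))

        shifts : Fin W → Fin p
        shifts w = res (+ toℕ w)

        shifts-injective : Injective _≡_ _≡_ shifts
        shifts-injective {v} {w} eq = toℕ-injective (+-injective (≈⇒≡
          (≈-trans (≈-sym (⟦res⟧ (+ toℕ v))) (≈-trans (≡⇒≈ (cong ⟦_⟧ eq)) (⟦res⟧ (+ toℕ w))))
          (ℕ.<-≤-trans (∣m-n∣<k (toℕ<n v) (toℕ<n w)) (ℕ.≤-trans W≤L L≤p))))

        slopes-injective : Injective _≡_ _≡_ (λ j → res (Y j))
        slopes-injective {i} {j} eq = Y-injective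
          (≈-trans (≈-sym (⟦res⟧ (Y i))) (≈-trans (≡⇒≈ (cong ⟦_⟧ eq)) (⟦res⟧ (Y j))))

        ψ-inside : ∀ x c → c ℕ.< L → ⟦ x ⟧ ≈ + c → ψ x ≡ d
        ψ-inside x c c<L e with toℕ x ℕ.<ᵇ L | ℕ.<⇒<ᵇ (subst (ℕ._< L) (sym x≡c) c<L)
          where
          x≡c : toℕ x ≡ c
          x≡c = +-injective (≈⇒≡ e (∣m-n∣<k (toℕ<n x) (ℕ.<-≤-trans c<L L≤p)))
        ... | true | _ = refl

        -- For a slope `Y j` and a shift below `W` every point lands in `z₀ + {0, …, 2W - 1}`, where
        -- `φ` takes its positive value `d`.
        incidence-full : ∀ j w → incidence (res (Y j)) (shifts w) ≡ + s * d
        incidence-full j w = trans (sum-cong-≗ value) (sum-const s d)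
          where
          value : ∀ i → term (res (Y j)) (shifts w) i ≡ d
          value i with c , c<W , e ← small i j =
            ψ-inside (res point) (c ℕ.+ toℕ w) (ℕ.+-mono-< c<W (toℕ<n w)) (≈-trans (⟦res⟧ point)
              (≈-combine₃ (X i) 1ℤ 1ℤ (⟦res⟧ (Y j)) (⟦res⟧ (+ toℕ w)) e
                (id ⟦ res (Y j) ⟧ (X i) (Y j) ⟦ shifts w ⟧ z₀ (+ c) (+ toℕ w))))
            where
            point : ℤ
            point = ⟦ res (Y j) ⟧ * X i + ⟦ shifts w ⟧ - z₀
            id : ∀ r x y v z c w → r * x + v - z - (c + w) ≡ x * (r - y) + 1ℤ * (v - w) + 1ℤ * (x * y - (z + c))
            id = solve-∀

        0≤square : ∀ x → 0ℤ ≤ x * x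
        0≤square (+ n) = 0≤* {+ n} {+ n} (+≤+ z≤n) (+≤+ z≤n)
        0≤square -[1+ n ] = +≤+ z≤n

        lower-bound : + m * (+ W * (+ s * d * (+ s * d))) ≤ sum (λ y → sum (λ w → incidence y w * incidence y w))
        lower-bound = begin
          + m * (+ W * (+ s * d * (+ s * d)))
            ≡⟨ sum-const m _ ⟨
          sum {m} (λ _ → + W * (+ s * d * (+ s * d)))
            ≡⟨ sum-cong-≗ (λ j → trans (sym (sum-const W _)) (sum-cong-≗ (λ w → sym (cong₂ _*_ (incidence-full j w) (incidence-full j w))))) ⟩
          sum (λ j → sum (λ w → incidence (res (Y j)) (shifts w) * incidence (res (Y j)) (shifts w)))
            ≤⟨ sum-mono (λ j → sum-injective-≤ shifts shifts-injective
                 (λ w → incidence (res (Y j)) w * incidence (res (Y j)) w) (λ w → 0≤square (incidence (res (Y j)) w))) ⟩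
          sum (λ j → sum (λ w → incidence (res (Y j)) w * incidence (res (Y j)) w))
            ≤⟨ sum-injective-≤ (λ j → res (Y j)) slopes-injective
                 (λ y → sum (λ w → incidence y w * incidence y w)) (λ y → sum-nonneg (λ w → 0≤square (incidence y w))) ⟩
          sum (λ y → sum (λ w → incidence y w * incidence y w)) ∎
          where open ≤-Reasoning

        0<d : 0ℤ < d
        0<d = ≤-<-trans (≤-reflexive (sym (+-inverseʳ (+ L)))) (+-monoˡ-< (- + L) (+<+ (ℕ.<-≤-trans (ℕ.m<m+n L 0<L) 2L≤p)))
          where
          0<L : 0 ℕ.< L
          0<L = ℕ.<-≤-trans 0<W W≤L

        p≤2d : + p ≤ + 2 * d
        p≤2d = 0≤i-j⇒j≤i (subst (0ℤ ≤_) (id (+ p) (+ L)) (i≤j⇒0≤j-i (+≤+ 2L≤p)))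
          where
          id : ∀ p L → p - (L + L) ≡ + 2 * (p - L) - p
          id = solve-∀

        -- Keeping only the `m * W` special pairs in the second moment gives `mW(sd)² ≤ sp²Ld`;
        -- since `L = 2W`, the factor `sWd` cancels.
        cancelled : + s * + m * d ≤ + 2 * (+ p * + p)
        cancelled = *-cancelʳ-≤ (0<* (0<* (+<+ 0<s) (+<+ 0<W)) 0<d)
          (subst₂ _≤_ (id₁ (+ m) (+ W) (+ s) d) (trans second-moment (id₂ (+ s) (+ W) (+ p) d)) lower-bound)
          where
          id₁ : ∀ m W s d → m * (W * (s * d * (s * d))) ≡ s * m * d * (s * W * d)
          id₁ = solve-∀
          id₂ : ∀ s W p d → s * (p * ((W + W) * d * p)) ≡ + 2 * (p * p) * (s * W * d)
          id₂ = solve-∀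

      sieve : s ℕ.* m ℕ.≤ 4 ℕ.* p
      sieve = drop‿+≤+ (subst₂ _≤_ (sym (pos-* s m)) (sym (pos-* 4 p)) (*-cancelʳ-≤ (+<+ 0<p) (begin
        + s * + m * + p          ≤⟨ *-monoˡ-≤-nonNeg (+ s * + m) {{nonNegative (0≤* {+ s} {+ m} (+≤+ z≤n) (+≤+ z≤n))}} p≤2d ⟩
        + s * + m * (+ 2 * d)    ≡⟨ id₁ (+ s) (+ m) d ⟩
        + 2 * (+ s * + m * d)    ≤⟨ *-monoˡ-≤-nonNeg (+ 2) cancelled ⟩
        + 2 * (+ 2 * (+ p * + p)) ≡⟨ id₂ (+ p) ⟩
        + 4 * + p * + p          ∎)))
        where
        open ≤-Reasoning
        0<p : 0 ℕ.< p
        0<p = ℕ.<-≤-trans 0<W (ℕ.≤-trans W≤L L≤p)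
        id₁ : ∀ s m d → s * m * (+ 2 * d) ≡ + 2 * (s * m * d)
        id₁ = solve-∀
        id₂ : ∀ p → + 2 * (+ 2 * (p * p)) ≡ + 4 * p * p
        id₂ = solve-∀

-- Small multipliers

+-cancelˡ : ∀ z x y → z + x ≡ z + y → x ≡ y
+-cancelˡ z x y eq = combine₁ 1ℤ eq (id z x y)
  where
  id : ∀ z x y → x - y ≡ 1ℤ * (z + x - (z + y))
  id = solve-∀

argmax : ∀ {n} (f : Fin (suc n) → ℤ) → ∃ λ i → ∀ j → f j ≤ f i
argmax {zero}  f = zero , λ { zero → ≤-refl }
argmax {suc n} f with argmax (f ∘ suc)
... | i , f≤ with f zero ≤? f (suc i)
...   | yes f0≤ = suc i , λ { zero → f0≤ ; (suc j) → f≤ j }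
...   | no f0≰  = zero , λ { zero → ≤-refl ; (suc j) → ≤-trans (f≤ j) (<⇒≤ (≰⇒> f0≰)) }

argmin : ∀ {n} (f : Fin (suc n) → ℤ) → ∃ λ i → ∀ j → f i ≤ f j
argmin f with i , f≤ ← argmax (λ j → - f j) = i , λ j → neg-cancel-≤ (f≤ j)

-- Pigeonhole with `t + 1` cells of length `q = N / (t + 1) + 1`: together they cover all values
-- below `N`, and two values in one cell differ by at most `q - 1`.
close-pair : ∀ {t N} (f : Fin (suc (suc t)) → ℕ) → Injective _≡_ _≡_ f → (∀ i → f i ℕ.< N) →
  ∃ λ i → ∃ λ j → f j ℕ.< f i × (f i ℕ.∸ f j) ℕ.* suc t ℕ.≤ N
close-pair {t} {N} f f-injective f<N = choose (pigeonhole (ℕ.n<1+n (suc t)) cell)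
  where
  q : ℕ
  q = suc (N ℕ./ suc t)
  N<tq : N ℕ.< suc t ℕ.* q
  N<tq = subst₂ ℕ._<_ (sym (ℕ.m≡m%n+[m/n]*n N (suc t))) (ℕ.*-comm q (suc t))
    (ℕ.+-monoˡ-< (N ℕ./ suc t ℕ.* suc t) (ℕ.m%n<n N (suc t)))
  cell : Fin (suc (suc t)) → Fin (suc t)
  cell i = fromℕ< (ℕ.m<n*o⇒m/o<n {f i} {suc t} {q} (ℕ.<-trans (f<N i) N<tq))
  gap : ∀ i j → f i ℕ./ q ≡ f j ℕ./ q → (f i ℕ.∸ f j) ℕ.* suc t ℕ.≤ N
  gap i j eq = ℕ.≤-trans (ℕ.*-monoˡ-≤ (suc t) (ℕ.s≤s⁻¹ (ℕ.m<n+o⇒m∸n<o (f i) (f j) (begin-strict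
    f i                            ≡⟨ ℕ.m≡m%n+[m/n]*n (f i) q ⟩
    f i ℕ.% q ℕ.+ f i ℕ./ q ℕ.* q  <⟨ ℕ.+-monoˡ-< (f i ℕ./ q ℕ.* q) (ℕ.m%n<n (f i) q) ⟩
    q ℕ.+ f i ℕ./ q ℕ.* q          ≡⟨ cong (λ c → q ℕ.+ c ℕ.* q) eq ⟩
    q ℕ.+ f j ℕ./ q ℕ.* q          ≤⟨ ℕ.+-monoʳ-≤ q (ℕ.m/n*n≤m (f j) q) ⟩
    q ℕ.+ f j                      ≡⟨ ℕ.+-comm q (f j) ⟩
    f j ℕ.+ q                      ∎)))) (ℕ.m/n*n≤m N (suc t))
    where open ℕ.≤-Reasoning
  choose : (∃ λ i → ∃ λ j → (i Data.Fin.< j) × cell i ≡ cell j) →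
    ∃ λ i → ∃ λ j → f j ℕ.< f i × (f i ℕ.∸ f j) ℕ.* suc t ℕ.≤ N
  choose (i , j , i<j , eq) with ℕ.<-cmp (f i) (f j)
  ... | tri< fi<fj _ _ = j , i , fi<fj , gap j i (sym (fromℕ<-injective _ _ _ _ eq))
  ... | tri≈ _ fi≡fj _ = ⊥-elim (<ᶠ⇒≢ i<j (f-injective fi≡fj))
  ... | tri> _ _ fj<fi = i , j , fj<fi , gap i j (fromℕ<-injective _ _ _ _ eq)

nonneg-shift : ∀ e E → ∣ e ∣ ℕ.≤ E → ∃ λ c → c ℕ.≤ E ℕ.+ E × + E + e ≡ + c
nonneg-shift (+ n) E n≤E = E ℕ.+ n , ℕ.+-monoʳ-≤ E n≤E , refl
nonneg-shift -[1+ n ] E n≤E = E ℕ.∸ suc n , ℕ.≤-trans (ℕ.m∸n≤m E (suc n)) (ℕ.m≤m+n E E) , ⊖-≥ n≤E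

∣∣-bound : ∀ {d m} → - m ≤ d → d ≤ m → ∣ d ∣ ℕ.≤ ∣ m ∣
∣∣-bound {+ n} {+ m} _ (+≤+ n≤m) = n≤m
∣∣-bound { -[1+ n ]} {+ suc m} (-≤- n≤m) _ = s≤s n≤m
∣∣-bound { -[1+ n ]} {+ 0} () _
∣∣-bound { -[1+ n ]} { -[1+ m ]} () _
∣∣-bound {+ n} { -[1+ m ]} _ ()

zero-multiple : ∀ d e m → ∣ d ∣ ℕ.< ∣ m ∣ → d + e * m ≡ 0ℤ → e ≡ 0ℤ
zero-multiple d e m ∣d∣<∣m∣ eq = ∣i∣≡0⇒i≡0 (ℕ.n<1⇒n≡0 (ℕ.*-cancelʳ-< (∣ m ∣) (∣ e ∣) 1 (begin-strict
  ∣ e ∣ ℕ.* ∣ m ∣   ≡⟨ abs-* e m ⟨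
  ∣ e * m ∣         ≡⟨ cong ∣_∣ (combine₁ {e * m} { - d} 1ℤ eq (id d (e * m))) ⟩
  ∣ - d ∣           ≡⟨ ∣-i∣≡∣i∣ d ⟩
  ∣ d ∣             <⟨ ∣d∣<∣m∣ ⟩
  ∣ m ∣             ≡⟨ ℕ.*-identityˡ (∣ m ∣) ⟨
  1 ℕ.* ∣ m ∣       ∎)))
  where
  open ℕ.≤-Reasoning
  id : ∀ d t → t - - d ≡ 1ℤ * (d + t - 0ℤ)
  id = solve-∀

remQuot-injective : ∀ {n} k {i j : Fin (n ℕ.* k)} → remQuot {n} k i ≡ remQuot k j → i ≡ j
remQuot-injective {n} k {i} {j} eq = trans (sym (combine-remQuot {n} k i))
  (trans (cong (λ (q , r) → combine q r) eq) (combine-remQuot {n} k j))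

-- 20772 = 36 · 577, where 36 makes the sieve applicable and the sieve then forces k ≤ 576.
sizes-absurd : ∀ {S T k N p} → 1 ℕ.≤ k → 1 ℕ.≤ N → 1 ℕ.≤ S ℕ.* T → N ℕ.≤ suc (S ℕ.* T) →
  S ℕ.* (T ℕ.* (k ℕ.* k)) ℕ.≤ 4 ℕ.* p → p ℕ.< suc k ℕ.* (N ℕ.* 36) → N ℕ.* 20772 ℕ.≤ p → ⊥
sizes-absurd {S} {T} {k} {N} {p} 1≤k 1≤N 1≤ST N≤ upper p< large = ℕ.<-irrefl refl (begin-strict
  N ℕ.* 20772           ≤⟨ large ⟩
  p                     <⟨ p< ⟩
  suc k ℕ.* (N ℕ.* 36)  ≤⟨ ℕ.*-monoˡ-≤ (N ℕ.* 36) (s≤s k≤576) ⟩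
  577 ℕ.* (N ℕ.* 36)    ≡⟨ ℕ.*-comm 577 (N ℕ.* 36) ⟩
  N ℕ.* 36 ℕ.* 577      ≡⟨ ℕ.*-assoc N 36 577 ⟩
  N ℕ.* 20772           ∎)
  where
  open ℕ.≤-Reasoning
  instance
    k≢0 : NonZero k
    k≢0 = ℕ.>-nonZero 1≤k
    N≢0 : NonZero N
    N≢0 = ℕ.>-nonZero 1≤N
  id₁ : ∀ S T k → S ℕ.* T ℕ.* k ℕ.* k ≡ S ℕ.* (T ℕ.* (k ℕ.* k))
  id₁ = solveℕ-∀
  id₂ : ∀ N k → 4 ℕ.* ((k ℕ.+ k) ℕ.* (N ℕ.* 36)) ≡ N ℕ.* 288 ℕ.* k
  id₂ = solveℕ-∀
  id₃ : ∀ M k → (M ℕ.+ M) ℕ.* k ≡ 2 ℕ.* (M ℕ.* k)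
  id₃ = solveℕ-∀
  id₄ : ∀ N → 2 ℕ.* (N ℕ.* 288) ≡ 576 ℕ.* N
  id₄ = solveℕ-∀
  STk≤288N : S ℕ.* T ℕ.* k ℕ.≤ N ℕ.* 288
  STk≤288N = ℕ.*-cancelʳ-≤ (S ℕ.* T ℕ.* k) (N ℕ.* 288) k (begin
    S ℕ.* T ℕ.* k ℕ.* k                ≡⟨ id₁ S T k ⟩
    S ℕ.* (T ℕ.* (k ℕ.* k))            ≤⟨ upper ⟩
    4 ℕ.* p                            ≤⟨ ℕ.*-monoʳ-≤ 4 (ℕ.<⇒≤ p<) ⟩
    4 ℕ.* (suc k ℕ.* (N ℕ.* 36))       ≤⟨ ℕ.*-monoʳ-≤ 4 (ℕ.*-monoˡ-≤ (N ℕ.* 36) (ℕ.+-monoˡ-≤ k 1≤k)) ⟩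
    4 ℕ.* ((k ℕ.+ k) ℕ.* (N ℕ.* 36))   ≡⟨ id₂ N k ⟩
    N ℕ.* 288 ℕ.* k                    ∎)
  k≤576 : k ℕ.≤ 576
  k≤576 = ℕ.*-cancelʳ-≤ k 576 N (begin
    k ℕ.* N                            ≡⟨ ℕ.*-comm k N ⟩
    N ℕ.* k                            ≤⟨ ℕ.*-monoˡ-≤ k (ℕ.≤-trans N≤ (ℕ.+-monoˡ-≤ (S ℕ.* T) 1≤ST)) ⟩
    (S ℕ.* T ℕ.+ S ℕ.* T) ℕ.* k        ≡⟨ id₃ (S ℕ.* T) k ⟩
    2 ℕ.* (S ℕ.* T ℕ.* k)              ≤⟨ ℕ.*-monoʳ-≤ 2 STk≤288N ⟩
    2 ℕ.* (N ℕ.* 288)                  ≡⟨ id₄ N ⟩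
    576 ℕ.* N                          ∎)

-- Decompositions of an interval and proportionality of difference vectors

module Decompositions (p : ℕ) .{{_ : NonZero p}} (p-prime : Prime p) where

  open Modular p
  open Field p-prime

  -- α and β enumerate A and B; the interval is ν + {0, …, N - 1}, so ν is n + 1.
  record Decomposition (N : ℕ) (ν : ℤ) (s t : ℕ) : Set where
    field
      α : Fin s → ℤ
      β : Fin t → ℤ
      α-injective : ∀ {i i'} → α i ≈ α i' → i ≡ i'
      β-injective : ∀ {j j'} → β j ≈ β j' → j ≡ j'
      α≉0 : ∀ i → ¬ α i ≈ 0ℤ
      β≉0 : ∀ j → ¬ β j ≈ 0ℤ
      r : Fin s → Fin t → ℕ
      r<N : ∀ i j → r i j ℕ.< N
      αβ≈ : ∀ i j → α i * β j ≈ ν + + r i j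
      cover : ∀ k → k ℕ.< N → ν + + k ≈ 0ℤ ⊎ ∃ λ i → ∃ λ j → α i * β j ≈ ν + + k

  swap : ∀ {N ν s t} → Decomposition N ν s t → Decomposition N ν t s
  swap {ν = ν} D = record
    { α = β ; β = α ; α-injective = β-injective ; β-injective = α-injective ; α≉0 = β≉0 ; β≉0 = α≉0
    ; r = λ j i → r i j ; r<N = λ j i → r<N i j
    ; αβ≈ = λ j i → subst (_≈ ν + + r i j) (*-comm (α i) (β j)) (αβ≈ i j)
    ; cover = λ k k<N → Sum.map (λ e → e)
        (λ (i , j , e) → j , i , subst (_≈ ν + + k) (*-comm (α i) (β j)) e) (cover k k<N) }
    where open Decomposition D

  -- A dilation `x` carrying `A` to small integers. As `B` has `t + 2` elements, `bound` reads
  -- `|P i₀| ≤ N/(|B| - 1)`; positivity of the largest entry is a normalisation.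
  record Multiplier {N ν s t} (D : Decomposition N ν s (suc (suc t))) : Set where
    open Decomposition D
    field
      x : ℤ
      P : Fin s → ℤ
      i₀ : Fin s
      x≉0 : ¬ x ≈ 0ℤ
      P≈ : ∀ i → P i ≈ x * α i
      0<P : 0ℤ < P i₀
      ∣P∣≤ : ∀ i → ∣ P i ∣ ℕ.≤ ∣ P i₀ ∣
      bound : ∣ P i₀ ∣ ℕ.* suc t ℕ.≤ N

  +-≈-cancel : ∀ {ν N m n} → N ℕ.≤ p → m ℕ.< N → n ℕ.< N → ν + + m ≈ ν + + n → m ≡ n
  +-≈-cancel {ν} {N} {m} {n} N≤p m<N n<N e = +-injective (≈⇒≡ (≈-combine₁ 1ℤ e (id ν (+ m) (+ n)))
    (ℕ.<-≤-trans (∣m-n∣<k m<N n<N) N≤p))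
    where
    id : ∀ ν m n → m - n ≡ 1ℤ * (ν + m - (ν + n))
    id = solve-∀

  module Facts {N ν s t} (D : Decomposition N ν s t) (N≤p : N ℕ.≤ p) where
    open Decomposition D

    r-injective : ∀ i {j j'} → r i j ≡ r i j' → j ≡ j'
    r-injective i {j} {j'} eq = β-injective (≈-cancelˡ (α≉0 i)
      (≈-trans (αβ≈ i j) (≈-trans (≡⇒≈ (cong (λ k → ν + + k) eq)) (≈-sym (αβ≈ i j')))))

    t≤N : Fin s → t ℕ.≤ N
    t≤N i = injective⇒≤ {f = λ j → fromℕ< (r<N i j)} (λ eq → r-injective i (fromℕ<-injective _ _ _ _ eq))

    -- The extra `1` accounts for a possible zero of the interval, which is coded apart from the
    -- pairs.
    N≤1+st : N ℕ.≤ suc (s ℕ.* t)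
    N≤1+st = injective⇒≤ {f = λ k → code (toℕ k) (cover (toℕ k) (toℕ<n k))}
      (λ {k} {l} eq → toℕ-injective (+-≈-cancel {ν} N≤p (toℕ<n k) (toℕ<n l)
        (code-injective (toℕ k) (toℕ l) (cover (toℕ k) (toℕ<n k)) (cover (toℕ l) (toℕ<n l)) eq)))
      where
      Covered : ℕ → Set
      Covered k = ν + + k ≈ 0ℤ ⊎ ∃ λ i → ∃ λ j → α i * β j ≈ ν + + k
      code : ∀ k → Covered k → Fin (suc (s ℕ.* t))
      code k (inj₁ _) = zero
      code k (inj₂ (i , j , _)) = suc (combine i j)
      code-injective : ∀ k l c d → code k c ≡ code l d → ν + + k ≈ ν + + l
      code-injective k l (inj₁ e) (inj₁ e') _ = ≈-trans e (≈-sym e')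
      code-injective k l (inj₂ (i , j , e)) (inj₂ (i' , j' , e')) eq
        with refl , refl ← combine-injective i j i' j' (sucᶠ-injective eq) = ≈-trans (≈-sym e) e'

  module Rank {N ν s t} (D : Decomposition N ν (suc s) (suc (suc t))) (large : N ℕ.* 20772 ℕ.≤ p) where
    open Decomposition D

    abstract
      ≤-from-large : ∀ c → c ℕ.≤ 20772 → N ℕ.* c ℕ.≤ p
      ≤-from-large c c≤ = ℕ.≤-trans (ℕ.*-monoʳ-≤ N c≤) large

      N≤p : N ℕ.≤ p
      N≤p = subst (ℕ._≤ p) (ℕ.*-identityʳ N) (≤-from-large 1 (ℕ.≤ᵇ⇒≤ 1 20772 tt))

      36N≤p : N ℕ.* 36 ℕ.≤ p
      36N≤p = ≤-from-large 36 (ℕ.≤ᵇ⇒≤ 36 20772 tt)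

    private
      open Facts D N≤p

      2≤N : 2 ℕ.≤ N
      2≤N = ℕ.≤-trans (s≤s (s≤s z≤n)) (t≤N zero)

      j₀ j₁ : Fin (suc (suc t))
      j₀ = zero
      j₁ = suc zero

      ρ : Fin (suc s) → ℤ
      ρ i = + r i j₀ - + r i j₁

      ρ≢0 : ∀ i → ρ i ≢ 0ℤ
      ρ≢0 i eq = j₀≢j₁ (r-injective i (+-injective (i-j≡0⇒i≡j (+ r i j₀) (+ r i j₁) eq)))
        where
        j₀≢j₁ : j₀ ≢ j₁
        j₀≢j₁ ()

      i₁ : Fin (suc s)
      -- Vectors proportional to `ρ` are also largest in this row, so a bound obtained here holds in
      -- all rows.
      i₁ = proj₁ (argmax (λ i → + ∣ ρ i ∣))

      ∣ρ∣≤ : ∀ i → ∣ ρ i ∣ ℕ.≤ ∣ ρ i₁ ∣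
      ∣ρ∣≤ i = drop‿+≤+ (proj₂ (argmax (λ i → + ∣ ρ i ∣)) i)

      h : ℕ
      h = ∣ ρ i₁ ∣

      instance
        h≢0 : NonZero h
        h≢0 = ℕ.≢-nonZero (λ eq → ρ≢0 i₁ (∣i∣≡0⇒i≡0 eq))

        N≢0 : NonZero N
        N≢0 = ℕ.>-nonZero (ℕ.<-≤-trans (s≤s z≤n) 2≤N)

      w : ℕ
      -- `w * h` is the smallest multiple of `h` exceeding `N`; it is at most `2N` because `h < N`,
      -- which keeps the sieve window short.
      w = suc (N ℕ./ h)

      g : Fin (suc s) → ℤ
      g i = + w * ρ i

      ∣g∣≡ : ∀ i → ∣ g i ∣ ≡ w ℕ.* ∣ ρ i ∣
      ∣g∣≡ i = abs-* (+ w) (ρ i)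

      ∣g∣≤∣g₁∣ : ∀ i → ∣ g i ∣ ℕ.≤ ∣ g i₁ ∣
      ∣g∣≤∣g₁∣ i = subst₂ ℕ._≤_ (sym (∣g∣≡ i)) (sym (∣g∣≡ i₁)) (ℕ.*-monoʳ-≤ w (∣ρ∣≤ i))

      N<∣g₁∣ : N ℕ.< ∣ g i₁ ∣
      N<∣g₁∣ = subst₂ ℕ._<_ (sym (ℕ.m≡m%n+[m/n]*n N h)) (sym (∣g∣≡ i₁))
        (ℕ.+-monoˡ-< (N ℕ./ h ℕ.* h) (ℕ.m%n<n N h))

      ∣g∣≤2N : ∀ i → ∣ g i ∣ ℕ.≤ 2 ℕ.* N
      ∣g∣≤2N i = ℕ.≤-trans (∣g∣≤∣g₁∣ i) (subst₂ ℕ._≤_ (sym (∣g∣≡ i₁)) (cong (λ n → N ℕ.+ n) (sym (ℕ.+-identityʳ N)))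
        (ℕ.+-mono-≤ (ℕ.<⇒≤ (∣m-n∣<k (r<N i₁ j₀) (r<N i₁ j₁))) (ℕ.m/n*n≤m N h)))

    module NotParallel (i₂ : Fin (suc s)) (k : ℕ) (36Nk≤p : k ℕ.* (N ℕ.* 36) ℕ.≤ p) (1≤k : 1 ℕ.≤ k) where

      -- The determinant of `(r i₁ j, r i₂ j)` against the direction `(g i₁, g i₂)`. It is blind to
      -- multiples of that direction, so it is constant in `j` exactly when the differences in these
      -- two rows are proportional to it.
      ℓ : Fin (suc (suc t)) → ℤ
      ℓ j = + r i₂ j * g i₁ - + r i₁ j * g i₂

      private
        jM jm : Fin (suc (suc t))
        jM = proj₁ (argmax ℓ)
        jm = proj₁ (argmin ℓ)

        ℓ≤ : ∀ j → ℓ j ≤ ℓ jM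
        ℓ≤ = proj₂ (argmax ℓ)

        ≤ℓ : ∀ j → ℓ jm ≤ ℓ j
        ≤ℓ = proj₂ (argmin ℓ)

        E W : ℕ
        -- Each of the two directions moves a value by at most `k * 2N`, hence `E = 4kN` and
        -- `W = N + 8kN`. For `k ≥ 1` this gives `4W ≤ 36kN`, the origin of `36`.
        E = k ℕ.* (2 ℕ.* N) ℕ.+ k ℕ.* (2 ℕ.* N)
        W = N ℕ.+ (E ℕ.+ E)

        F : Fin (suc s) → ℤ
        F i = + 2 * (+ r i jM - + r i jm)

        offset : ∀ i (x y : Fin k) → ℤ
        offset i x y = + toℕ x * F i + + toℕ y * g i

        ∣offset∣≤ : ∀ i x y → ∣ offset i x y ∣ ℕ.≤ E
        ∣offset∣≤ i x y = ℕ.≤-trans (∣i+j∣≤∣i∣+∣j∣ (+ toℕ x * F i) (+ toℕ y * g i)) (ℕ.+-mono-≤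
          (subst (ℕ._≤ k ℕ.* (2 ℕ.* N)) (sym (abs-* (+ toℕ x) (F i)))
            (ℕ.*-mono-≤ (ℕ.<⇒≤ (toℕ<n x)) (subst (ℕ._≤ 2 ℕ.* N) (sym (abs-* (+ 2) (+ r i jM - + r i jm)))
              (ℕ.*-monoʳ-≤ 2 (ℕ.<⇒≤ (∣m-n∣<k (r<N i jM) (r<N i jm)))))))
          (subst (ℕ._≤ k ℕ.* (2 ℕ.* N)) (sym (abs-* (+ toℕ y) (g i)))
            (ℕ.*-mono-≤ (ℕ.<⇒≤ (toℕ<n y)) (∣g∣≤2N i))))

        -- Doubling β jM - β jm and taking w with w ∣ρ i₁∣ > N keeps translates by different (x , y) disjoint.
        point : Fin (suc (suc t)) → Fin k → Fin k → ℤ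
        point j x y = β j + (+ toℕ x * (+ 2 * (β jM - β jm)) + + toℕ y * (+ w * (β j₀ - β j₁)))

        point≈ : ∀ i j x y → α i * point j x y ≈ ν + (+ r i j + offset i x y)
        point≈ i j x y = ≈-combine₃ 1ℤ (+ toℕ x * + 2) (+ toℕ y * + w) (αβ≈ i j) (difference jM jm) (difference j₀ j₁)
          (id (α i) (β j) (β jM) (β jm) (β j₀) (β j₁) (+ toℕ x) (+ toℕ y) (+ w) ν (+ r i j) (+ r i jM) (+ r i jm) (+ r i j₀) (+ r i j₁))
          where
          difference : ∀ j j' → α i * (β j - β j') ≈ + r i j - + r i j'
          difference j j' = ≈-combine₂ 1ℤ -1ℤ (αβ≈ i j) (αβ≈ i j') (id' (α i) (β j) (β j') ν (+ r i j) (+ r i j'))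
            where
            id' : ∀ a b b' ν r r' → a * (b - b') - (r - r') ≡ 1ℤ * (a * b - (ν + r)) + -1ℤ * (a * b' - (ν + r'))
            id' = solve-∀
          id : ∀ a b bM bm b₀ b₁ x y w ν r rM rm r₀ r₁ →
            a * (b + (x * (+ 2 * (bM - bm)) + y * (w * (b₀ - b₁)))) -
            (ν + (r + (x * (+ 2 * (rM - rm)) + y * (w * (r₀ - r₁))))) ≡
            1ℤ * (a * b - (ν + r)) + x * + 2 * (a * (bM - bm) - (rM - rm)) + y * w * (a * (b₀ - b₁) - (r₀ - r₁))
          id = solve-∀

        encode : ∀ i j x y → ∃ λ c → c ℕ.< W × + E + (+ r i j + offset i x y) ≡ + c
        encode i j x y = from (nonneg-shift (offset i x y) E (∣offset∣≤ i x y))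
          where
          id : ∀ E r o → E + (r + o) ≡ r + (E + o)
          id = solve-∀
          from : (∃ λ c → c ℕ.≤ E ℕ.+ E × + E + offset i x y ≡ + c) →
            ∃ λ c → c ℕ.< W × + E + (+ r i j + offset i x y) ≡ + c
          from (c , c≤ , eq) = r i j ℕ.+ c , ℕ.+-mono-<-≤ (r<N i j) c≤ ,
            trans (id (+ E) (+ r i j) (offset i x y)) (cong (λ z → + r i j + z) eq)

        4W≤p : 4 ℕ.* W ℕ.≤ p
        4W≤p = begin
          4 ℕ.* W                                             ≡⟨ id₁ N k ⟩
          4 ℕ.* (1 ℕ.* N) ℕ.+ 32 ℕ.* (k ℕ.* N)                ≤⟨ ℕ.+-monoˡ-≤ _ (ℕ.*-monoʳ-≤ 4 (ℕ.*-monoˡ-≤ N 1≤k)) ⟩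
          4 ℕ.* (k ℕ.* N) ℕ.+ 32 ℕ.* (k ℕ.* N)                ≡⟨ id₂ N k ⟩
          k ℕ.* (N ℕ.* 36)                                    ≤⟨ 36Nk≤p ⟩
          p                                                   ∎
          where
          open ℕ.≤-Reasoning
          id₁ : ∀ N k → 4 ℕ.* (N ℕ.+ (k ℕ.* (2 ℕ.* N) ℕ.+ k ℕ.* (2 ℕ.* N) ℕ.+ (k ℕ.* (2 ℕ.* N) ℕ.+ k ℕ.* (2 ℕ.* N)))) ≡
            4 ℕ.* (1 ℕ.* N) ℕ.+ 32 ℕ.* (k ℕ.* N)
          id₁ = solveℕ-∀
          id₂ : ∀ N k → 4 ℕ.* (k ℕ.* N) ℕ.+ 32 ℕ.* (k ℕ.* N) ≡ k ℕ.* (N ℕ.* 36)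
          id₂ = solveℕ-∀

        W≤p : W ℕ.≤ p
        W≤p = ℕ.≤-trans (ℕ.m≤m+n W _) 4W≤p

        -- Congruent points have congruent values in each row, and after adding `E` all values lie
        -- in `{0, …, W - 1}` with `W ≤ p`, so no wrap-around is possible.
        values-equal : ∀ i j x y j' x' y' → point j x y ≈ point j' x' y' →
          + r i j + offset i x y ≡ + r i j' + offset i x' y'
        values-equal i j x y j' x' y' e = compare (encode i j x y) (encode i j' x' y')
          where
          V V' : ℤ
          V = + r i j + offset i x y
          V' = + r i j' + offset i x' y'
          compare : (∃ λ c → c ℕ.< W × + E + V ≡ + c) → (∃ λ c → c ℕ.< W × + E + V' ≡ + c) → V ≡ V'
          compare (c , c<W , eq) (c' , c'<W , eq') = +-cancelˡ (+ E) V V' (trans eq (trans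
            (≈⇒≡ (subst₂ _≈_ eq eq' (≈-combine₃ -1ℤ 1ℤ (α i) (point≈ i j x y) (point≈ i j' x' y') e
              (id ν (+ E) V V' (α i) (point j x y) (point j' x' y'))))
              (ℕ.<-≤-trans (∣m-n∣<k c<W c'<W) W≤p)) (sym eq')))
            where
            id : ∀ ν E V V' a q q' → E + V - (E + V') ≡ -1ℤ * (a * q - (ν + V)) + 1ℤ * (a * q' - (ν + V')) + a * (q - q')
            id = solve-∀

        module _ (ℓm<ℓM : ℓ jm < ℓ jM) where

          private
            Δ : ℤ
            Δ = ℓ jM - ℓ jm

            0<Δ : 0ℤ < Δ
            0<Δ = subst (_< Δ) (+-inverseʳ (ℓ jm)) (+-monoˡ-< (- ℓ jm) ℓm<ℓM)

            ℓ-difference : ∀ j j' → ℓ j - ℓ j' ≤ Δ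
            ℓ-difference j j' = +-mono-≤ (ℓ≤ j) (neg-mono-≤ (≤ℓ j'))

            ∣ℓ-difference∣ : ∀ j j' → ∣ ℓ j - ℓ j' ∣ ℕ.< ∣ + 2 * Δ ∣
            ∣ℓ-difference∣ j j' = ℕ.≤-<-trans
              (∣∣-bound (subst (- Δ ≤_) (id (ℓ j') (ℓ j)) (neg-mono-≤ (ℓ-difference j' j))) (ℓ-difference j j'))
              (subst (∣ Δ ∣ ℕ.<_) (sym (abs-* (+ 2) Δ)) (ℕ.m<m+n (∣ Δ ∣) (ℕ.≤-trans (ℕ.n≢0⇒n>0 (λ eq → 0<⇒≢0 0<Δ (∣i∣≡0⇒i≡0 eq))) (ℕ.m≤m+n _ 0))))
              where
              id : ∀ x y → - (x - y) ≡ y - x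
              id = solve-∀

            -- Taking the determinant of rows `i₁` and `i₂` eliminates `y` and leaves
            -- `ℓ j - ℓ j' + (x - x')2Δ = 0`, while `|ℓ j - ℓ j'| ≤ Δ < 2Δ`.
            x-equal : ∀ j x y j' x' y' → point j x y ≈ point j' x' y' → x ≡ x'
            x-equal j x y j' x' y' e = toℕ-injective (+-injective (i-j≡0⇒i≡j (+ toℕ x) (+ toℕ x')
              (zero-multiple (ℓ j - ℓ j') (+ toℕ x - + toℕ x') (+ 2 * Δ) (∣ℓ-difference∣ j j')
                (combine₂ (g i₁) (- g i₂) (values-equal i₂ j x y j' x' y' e) (values-equal i₁ j x y j' x' y' e)
                  (id (g i₁) (g i₂) (+ toℕ x) (+ toℕ x') (+ toℕ y) (+ toℕ y')
                    (+ r i₁ j) (+ r i₁ j') (+ r i₁ jM) (+ r i₁ jm) (+ r i₂ j) (+ r i₂ j') (+ r i₂ jM) (+ r i₂ jm))))))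
              where
              id : ∀ g₁ g₂ x x' y y' r r' rM rm q q' qM qm →
                (q * g₁ - r * g₂ - (q' * g₁ - r' * g₂)) + (x - x') * (+ 2 * (qM * g₁ - rM * g₂ - (qm * g₁ - rm * g₂))) - 0ℤ ≡
                g₁ * (q + (x * (+ 2 * (qM - qm)) + y * g₂) - (q' + (x' * (+ 2 * (qM - qm)) + y' * g₂))) +
                - g₂ * (r + (x * (+ 2 * (rM - rm)) + y * g₁) - (r' + (x' * (+ 2 * (rM - rm)) + y' * g₁)))
              id = solve-∀

            -- Once the `x` terms cancel, row `i₁` alone suffices: it reads
            -- `r i₁ j - r i₁ j' + (y - y')g i₁ = 0` with `|r i₁ j - r i₁ j'| < N < |g i₁|`.
            yj-equal : ∀ j x y j' x' y' → point j x y ≈ point j' x' y' → x ≡ x' → y ≡ y' × j ≡ j'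
            yj-equal j x y j' x' y' e refl = y≡y' , r-injective i₁ (r≡r' y≡y' (values-equal i₁ j x y j' x y' e))
              where
              id : ∀ r r' z y y' g → r - r' + (y - y') * g - 0ℤ ≡ 1ℤ * (r + (z + y * g) - (r' + (z + y' * g)))
              id = solve-∀
              y≡y' : y ≡ y'
              y≡y' = toℕ-injective (+-injective (i-j≡0⇒i≡j (+ toℕ y) (+ toℕ y')
                (zero-multiple (+ r i₁ j - + r i₁ j') (+ toℕ y - + toℕ y') (g i₁)
                  (ℕ.<-trans (∣m-n∣<k (r<N i₁ j) (r<N i₁ j')) N<∣g₁∣)
                  (combine₁ 1ℤ (values-equal i₁ j x y j' x y' e) (id (+ r i₁ j) (+ r i₁ j') (+ toℕ x * F i₁) (+ toℕ y) (+ toℕ y') (g i₁))))))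
              id' : ∀ r r' z → r - r' ≡ 1ℤ * (r + z - (r' + z))
              id' = solve-∀
              r≡r' : y ≡ y' → + r i₁ j + offset i₁ x y ≡ + r i₁ j' + offset i₁ x y' → r i₁ j ≡ r i₁ j'
              r≡r' refl eq = +-injective (combine₁ 1ℤ eq (id' (+ r i₁ j) (+ r i₁ j') (offset i₁ x y)))

            split : Fin (suc (suc t) ℕ.* (k ℕ.* k)) → Fin (suc (suc t)) × Fin (k ℕ.* k)
            split = remQuot (k ℕ.* k)

            split′ : Fin (suc (suc t) ℕ.* (k ℕ.* k)) → Fin k × Fin k
            split′ q = remQuot {k} k (proj₂ (split q))

            Y : Fin (suc (suc t) ℕ.* (k ℕ.* k)) → ℤ
            Y q = point (proj₁ (split q)) (proj₁ (split′ q)) (proj₂ (split′ q))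

            Y-injective : ∀ {q q'} → Y q ≈ Y q' → q ≡ q'
            Y-injective {q} {q'} e = remQuot-injective {suc (suc t)} (k ℕ.* k)
              (cong₂ _,_ (proj₂ yj≡) (remQuot-injective {k} k (cong₂ _,_ x≡ (proj₁ yj≡))))
              where
              j = proj₁ (split q)
              x = proj₁ (split′ q)
              y = proj₂ (split′ q)
              j' = proj₁ (split q')
              x' = proj₁ (split′ q')
              y' = proj₂ (split′ q')
              x≡ : x ≡ x'
              x≡ = x-equal j x y j' x' y' e
              yj≡ : y ≡ y' × j ≡ j'
              yj≡ = yj-equal j x y j' x' y' e x≡

            small : ∀ i q → ∃ λ c → c ℕ.< W × α i * Y q ≈ ν - + E + + c
            small i q = from (encode i j x y)
              where
              j = proj₁ (split q)
              x = proj₁ (split′ q)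
              y = proj₂ (split′ q)
              V : ℤ
              V = + r i j + offset i x y
              id : ∀ z ν V E c → z - (ν - E + c) ≡ 1ℤ * (z - (ν + V)) + 1ℤ * (E + V - c)
              id = solve-∀
              from : (∃ λ c → c ℕ.< W × + E + V ≡ + c) → ∃ λ c → c ℕ.< W × α i * Y q ≈ ν - + E + + c
              from (c , c<W , eq) = c , c<W ,
                ≈-combine₂ 1ℤ 1ℤ (point≈ i j x y) (≡⇒≈ eq) (id (α i * Y q) ν V (+ E) (+ c))

          sieve-bound : suc s ℕ.* (suc (suc t) ℕ.* (k ℕ.* k)) ℕ.≤ 4 ℕ.* p
          sieve-bound = Sieve.sieve α Y (ν - + E) α-injective (λ {q} {q'} → Y-injective {q} {q'}) (s≤s z≤n)
            (ℕ.<-≤-trans (ℕ.<-≤-trans (s≤s z≤n) 2≤N) (ℕ.m≤m+n N (E ℕ.+ E))) 4W≤p small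

      parallel′ : (ℓ jm < ℓ jM → ⊥) → ∀ j j' → ℓ j ≡ ℓ j'
      parallel′ ℓm≮ℓM j j' = ≤-antisym (below j j') (below j' j)
        where
        below : ∀ j j' → ℓ j ≤ ℓ j'
        below j j' = ≤-trans (ℓ≤ j) (≤-trans (≮⇒≥ ℓm≮ℓM) (≤ℓ j'))

      parallel : p ℕ.< suc k ℕ.* (N ℕ.* 36) → ∀ j j' → ℓ j ≡ ℓ j'
      parallel p< = parallel′ (λ ℓm<ℓM → sizes-absurd {suc s} {suc (suc t)} 1≤k (ℕ.<-≤-trans (s≤s z≤n) 2≤N) (s≤s z≤n) N≤1+st (sieve-bound ℓm<ℓM) p< large)

    -- The entries `P i` are differences of two columns of `r`, hence proportional to `g i`; as
    -- `|g i|` is largest at `i₁`, the small gap found in that row dominates all other rows.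
    multiplier : Multiplier D
    multiplier = from (close-pair (r i₁) (r-injective i₁) (r<N i₁))
      where
      instance
        36N≢0 : NonZero (N ℕ.* 36)
        36N≢0 = ℕ.m*n≢0 N 36
      k : ℕ
      -- The largest `k` whose window fits the sieve; its maximality is the upper bound `p<` that
      -- `sizes-absurd` plays against the sieve.
      k = p ℕ./ (N ℕ.* 36)
      p< : p ℕ.< suc k ℕ.* (N ℕ.* 36)
      p< = subst (ℕ._< suc k ℕ.* (N ℕ.* 36)) (sym (ℕ.m≡m%n+[m/n]*n p (N ℕ.* 36)))
        (ℕ.+-monoˡ-< (k ℕ.* (N ℕ.* 36)) (ℕ.m%n<n p (N ℕ.* 36)))
      parallel : ∀ i j j' → + r i j * g i₁ - + r i₁ j * g i ≡ + r i j' * g i₁ - + r i₁ j' * g i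
      parallel i = NotParallel.parallel i k (ℕ.m/n*n≤m p (N ℕ.* 36)) 1≤k p<
        where
        1≤k : 1 ℕ.≤ k
        1≤k = ℕ.m≥n⇒m/n>0 36N≤p
      from : (∃ λ j → ∃ λ j' → r i₁ j' ℕ.< r i₁ j × (r i₁ j ℕ.∸ r i₁ j') ℕ.* suc t ℕ.≤ N) → Multiplier D
      from (j , j' , r'<r , gap) = record
        { x = β j - β j'
        ; P = P
        ; i₀ = i₁
        ; x≉0 = λ e → ℕ.<-irrefl (cong (r i₁) (sym (β-injective (≈-combine₁ 1ℤ e (id₁ (β j) (β j')))))) r'<r
        ; P≈ = λ i → ≈-combine₂ -1ℤ 1ℤ (αβ≈ i j) (αβ≈ i j') (id₂ (α i) (β j) (β j') ν (+ r i j) (+ r i j'))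
        ; 0<P = subst (_< P i₁) (+-inverseʳ (+ r i₁ j')) (+-monoˡ-< (- + r i₁ j') (+<+ r'<r))
        ; ∣P∣≤ = λ i → ℕ.*-cancelʳ-≤ (∣ P i ∣) (∣ P i₁ ∣) (∣ g i₁ ∣) {{ℕ.>-nonZero (ℕ.≤-<-trans z≤n N<∣g₁∣)}}
            (subst (ℕ._≤ ∣ P i₁ ∣ ℕ.* ∣ g i₁ ∣) (sym (proportional i)) (ℕ.*-monoʳ-≤ (∣ P i₁ ∣) (∣g∣≤∣g₁∣ i)))
        ; bound = subst (λ n → n ℕ.* suc t ℕ.≤ N)
            (sym (cong ∣_∣ (trans (m-n≡m⊖n (r i₁ j) (r i₁ j')) (⊖-≥ (ℕ.<⇒≤ r'<r))))) gap
        }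
        where
        P : Fin (suc s) → ℤ
        P i = + r i j - + r i j'
        id₁ : ∀ b b' → b - b' ≡ 1ℤ * (b - b' - 0ℤ)
        id₁ = solve-∀
        id₂ : ∀ a b b' ν r r' → r - r' - (b - b') * a ≡ -1ℤ * (a * b - (ν + r)) + 1ℤ * (a * b' - (ν + r'))
        id₂ = solve-∀
        id₃ : ∀ q q' r r' g₁ g → (q - q') * g₁ - (r - r') * g ≡ 1ℤ * (q * g₁ - r * g - (q' * g₁ - r' * g))
        id₃ = solve-∀
        proportional : ∀ i → ∣ P i ∣ ℕ.* ∣ g i₁ ∣ ≡ ∣ P i₁ ∣ ℕ.* ∣ g i ∣
        proportional i = trans (sym (abs-* (P i) (g i₁))) (trans (cong ∣_∣
          (combine₁ {P i * g i₁} {P i₁ * g i} 1ℤ (parallel i j j') (id₃ (+ r i j) (+ r i j') (+ r i₁ j) (+ r i₁ j') (g i₁) (g i)))) (abs-* (P i₁) (g i)))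

-- Lifting the products to integers

product-bound : ∀ {a b s t N} → 1 ℕ.≤ N → a ℕ.* suc t ℕ.≤ N → b ℕ.* suc s ℕ.≤ N →
  N ℕ.≤ suc (suc (suc s) ℕ.* suc (suc t)) → a ℕ.* b ℕ.≤ 8 ℕ.* N
product-bound {a} {b} {s} {t} {N} 1≤N at≤N bs≤N N≤ = ℕ.*-cancelʳ-≤ (a ℕ.* b) (8 ℕ.* N) N {{ℕ.>-nonZero 1≤N}} (begin
  a ℕ.* b ℕ.* N                                     ≤⟨ ℕ.*-monoʳ-≤ (a ℕ.* b) N≤8st ⟩
  a ℕ.* b ℕ.* (8 ℕ.* (suc s ℕ.* suc t))             ≡⟨ id₁ a b (suc s) (suc t) ⟩
  8 ℕ.* ((a ℕ.* suc t) ℕ.* (b ℕ.* suc s))           ≤⟨ ℕ.*-monoʳ-≤ 8 (ℕ.*-mono-≤ at≤N bs≤N) ⟩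
  8 ℕ.* (N ℕ.* N)                                   ≡⟨ ℕ.*-assoc 8 N N ⟨
  8 ℕ.* N ℕ.* N                                     ∎)
  where
  open ℕ.≤-Reasoning
  id₁ : ∀ a b s t → a ℕ.* b ℕ.* (8 ℕ.* (s ℕ.* t)) ≡ 8 ℕ.* ((a ℕ.* t) ℕ.* (b ℕ.* s))
  id₁ = solveℕ-∀
  id₂ : ∀ s t → 8 ℕ.* ((1 ℕ.+ s) ℕ.* (1 ℕ.+ t)) ≡ (1 ℕ.+ (2 ℕ.+ s) ℕ.* (2 ℕ.+ t)) ℕ.+ (3 ℕ.+ 6 ℕ.* s ℕ.+ 6 ℕ.* t ℕ.+ 7 ℕ.* (s ℕ.* t))
  id₂ = solveℕ-∀
  -- Source of the `8`: `|A||B| + 1 ≤ 8(|A| - 1)(|B| - 1)` once both sizes are at least `2`.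
  N≤8st : N ℕ.≤ 8 ℕ.* (suc s ℕ.* suc t)
  N≤8st = ℕ.≤-trans N≤ (subst (suc (suc (suc s) ℕ.* suc (suc t)) ℕ.≤_) (sym (id₂ s t)) (ℕ.m≤m+n _ _))

module Core (p : ℕ) .{{_ : NonZero p}} (p-prime : Prime p) where

  open Modular p
  open Field p-prime
  open Decompositions p p-prime

  module MultiplierFacts {N ν s t} (D : Decomposition N ν (suc (suc s)) (suc (suc t))) (M : Multiplier D) where
    open Decomposition D
    open Multiplier M

    P-reflects : ∀ i z → P i ≈ x * z → α i ≈ z
    P-reflects i z e = ≈-cancelˡ x≉0 (≈-trans (≈-sym (P≈ i)) e)

    P-equal : ∀ i i' → P i ≡ P i' → α i ≈ α i'
    P-equal i i' eq = P-reflects i (α i') (≈-trans (≡⇒≈ eq) (P≈ i'))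

    P-opposite : ∀ i i' → P i ≡ - P i' → α i ≈ - α i'
    P-opposite i i' eq = P-reflects i (- α i') (≈-combine₂ 1ℤ -1ℤ (≡⇒≈ eq) (P≈ i') (id (P i) (P i') x (α i')))
      where
      id : ∀ P P' x α → P - x * - α ≡ 1ℤ * (P - - P') + -1ℤ * (P' - x * α)
      id = solve-∀

    P≢0 : ∀ i → P i ≢ 0ℤ
    P≢0 i eq = α≉0 i (P-reflects i 0ℤ (≡⇒≈ (trans eq (sym (*-zeroʳ x)))))

    P-varies : ∃ λ i → P i ≢ P i₀
    P-varies = from i₀ refl
      where
      from : ∀ i → i ≡ i₀ → ∃ λ i → P i ≢ P i₀
      from zero eq = suc zero , λ P≡ → zero≢suc (trans eq (sym (α-injective (P-equal (suc zero) i₀ P≡))))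
        where
        zero≢suc : zero ≢ suc zero
        zero≢suc ()
      from (suc i) eq = zero , λ P≡ → zero≢suc (trans (α-injective (P-equal zero i₀ P≡)) (sym eq))
        where
        zero≢suc : zero ≢ suc i
        zero≢suc ()

    ±-classes : (∀ i → P i ≡ P i₀ ⊎ P i ≡ - P i₀) → ∀ i → α i ≈ α i₀ ⊎ α i ≈ - α i₀
    ±-classes P± i = Sum.map (P-equal i i₀) (P-opposite i i₀) (P± i)

  module _ {N ν s t} (D : Decomposition N ν (suc (suc s)) (suc (suc t))) (large : N ℕ.* 20772 ℕ.≤ p) where
    open Decomposition D

    -- For `N ≡ 3` the middle element of the interval is `ν + 1`, so the last alternative says that
    -- this element is `± 3*`.
    CoreConclusion : Set
    CoreConclusion = (∃ λ i₀ → ∀ i → α i ≈ α i₀ ⊎ α i ≈ - α i₀) ⊎ (∃ λ j₀ → ∀ j → β j ≈ β j₀ ⊎ β j ≈ - β j₀) ⊎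
      (N ≡ 3 × (+ 3 * (ν + 1ℤ) ≈ 1ℤ ⊎ + 3 * (ν + 1ℤ) ≈ -1ℤ))

    module Integral (MA : Multiplier D) (MB : Multiplier (swap D)) (N≤p : N ℕ.≤ p) (32N<p : N ℕ.* 32 ℕ.< p) where

      open Facts D N≤p
      open Multiplier MA using (P; i₀; x; x≉0; P≈; 0<P; ∣P∣≤) renaming (bound to P-bound)
      open Multiplier MB using () renaming (P to R; i₀ to j₀; x to y; x≉0 to y≉0; P≈ to R≈; 0<P to 0<R; ∣P∣≤ to ∣R∣≤; bound to R-bound)
      open MultiplierFacts D MA
      open MultiplierFacts (swap D) MB using () renaming (P≢0 to R≢0; P-varies to R-varies; ±-classes to R-±-classes)

      2≤N : 2 ℕ.≤ N
      2≤N = ℕ.≤-trans (s≤s (s≤s z≤n)) (t≤N zero)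

      X σ : ℤ
      X = P i₀ * R j₀
      σ = x * y

      0<X : 0ℤ < X
      0<X = 0<* 0<P 0<R

      σ≉0 : ¬ σ ≈ 0ℤ
      σ≉0 e = Sum.[ x≉0 , y≉0 ] (*≈0 x y e)

      ∣X∣≤8N : ∣ X ∣ ℕ.≤ 8 ℕ.* N
      ∣X∣≤8N = subst (ℕ._≤ 8 ℕ.* N) (sym (abs-* (P i₀) (R j₀)))
        (product-bound {∣ P i₀ ∣} {∣ R j₀ ∣} {s} {t} (ℕ.<-≤-trans (s≤s z≤n) 2≤N) P-bound R-bound N≤1+st)

      Value : ℤ → Set
      Value z = z ≡ 0ℤ ⊎ ∃ λ i → ∃ λ j → P i * R j ≡ z

      ∣Value∣≤ : ∀ {z} → Value z → ∣ z ∣ ℕ.≤ ∣ X ∣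
      ∣Value∣≤ (inj₁ refl) = z≤n
      ∣Value∣≤ (inj₂ (i , j , refl)) = subst₂ ℕ._≤_ (sym (abs-* (P i) (R j))) (sym (abs-* (P i₀) (R j₀))) (ℕ.*-mono-≤ (∣P∣≤ i) (∣R∣≤ j))

      product≈ : ∀ i j {k} → α i * β j ≈ ν + k → P i * R j ≈ σ * (ν + k)
      product≈ i j {k} e = ≈-combine₃ (R j) (x * α i) σ (P≈ i) (R≈ j) e (id (P i) (R j) x y (α i) (β j) ν k)
        where
        id : ∀ P R x y a b ν k → P * R - x * y * (ν + k) ≡ R * (P - x * a) + x * a * (R - y * b) + x * y * (a * b - (ν + k))
        id = solve-∀

      value : ∀ k → k ℕ.< N → ∃ λ z → Value z × z ≈ σ * (ν + + k)
      value k k<N = from (cover k k<N)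
        where
        from : ν + + k ≈ 0ℤ ⊎ (∃ λ i → ∃ λ j → α i * β j ≈ ν + + k) → ∃ λ z → Value z × z ≈ σ * (ν + + k)
        from (inj₁ e) = 0ℤ , inj₁ refl , ≈-combine₁ (- σ) e (id σ (ν + + k))
          where
          id : ∀ σ n → 0ℤ - σ * n ≡ - σ * (n - 0ℤ)
          id = solve-∀
        from (inj₂ (i , j , e)) = P i * R j , inj₂ (i , j , refl) , product≈ i j e

      z₀ z₁ τ : ℤ
      z₀ = proj₁ (value 0 (ℕ.<-≤-trans (s≤s z≤n) 2≤N))
      z₁ = proj₁ (value 1 2≤N)
      τ = z₁ - z₀

      z₀-value : Value z₀
      z₀-value = proj₁ (proj₂ (value 0 (ℕ.<-≤-trans (s≤s z≤n) 2≤N)))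

      z₁-value : Value z₁
      z₁-value = proj₁ (proj₂ (value 1 2≤N))

      z₀≈ : z₀ ≈ σ * (ν + + 0)
      z₀≈ = proj₂ (proj₂ (value 0 (ℕ.<-≤-trans (s≤s z≤n) 2≤N)))

      z₁≈ : z₁ ≈ σ * (ν + + 1)
      z₁≈ = proj₂ (proj₂ (value 1 2≤N))

      τ≈σ : τ ≈ σ
      τ≈σ = ≈-combine₂ 1ℤ -1ℤ z₁≈ z₀≈ (id z₁ z₀ σ ν)
        where
        id : ∀ z₁ z₀ σ ν → z₁ - z₀ - σ ≡ 1ℤ * (z₁ - σ * (ν + + 1)) + -1ℤ * (z₀ - σ * (ν + + 0))
        id = solve-∀

      4∣X∣<p : ∣ X ∣ ℕ.+ (∣ X ∣ ℕ.+ (∣ X ∣ ℕ.+ ∣ X ∣)) ℕ.< p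
      4∣X∣<p = ℕ.≤-<-trans (ℕ.+-mono-≤ ∣X∣≤8N (ℕ.+-mono-≤ ∣X∣≤8N (ℕ.+-mono-≤ ∣X∣≤8N ∣X∣≤8N))) (subst (ℕ._< p) (id N) 32N<p)
        where
        id : ∀ N → N ℕ.* 32 ≡ 8 ℕ.* N ℕ.+ (8 ℕ.* N ℕ.+ (8 ℕ.* N ℕ.+ 8 ℕ.* N))
        id = solveℕ-∀

      -- The size of `k * τ` is not controlled in advance, so the comparison advances one step at a
      -- time: `z - (z' + τ)` is divisible by `p` and is a combination of four values, each at most
      -- `|X|` in absolute value, while `4|X| < p`.
      value-unique : ∀ k → k ℕ.< N → ∀ {z} → Value z → z ≈ σ * (ν + + k) → z ≡ z₀ + + k * τ
      value-unique zero _ {z} v e = trans (≈⇒≡ (≈-trans e (≈-sym z₀≈)) (ℕ.≤-<-trans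
          (ℕ.≤-trans (∣i-j∣≤∣i∣+∣j∣ z z₀) (ℕ.+-mono-≤ (∣Value∣≤ v) (ℕ.≤-trans (∣Value∣≤ z₀-value) (ℕ.m≤m+n _ _)))) 4∣X∣<p))
        (id z₀ τ)
        where
        id : ∀ z₀ τ → z₀ ≡ z₀ + + 0 * τ
        id = solve-∀
      value-unique (suc k) k<N {z} v e = from (value k (ℕ.<⇒≤ k<N))
        where
        id₁ : ∀ z z' σ ν k τ → z - (z' + τ) ≡ 1ℤ * (z - σ * (ν + (1ℤ + k))) + -1ℤ * (z' - σ * (ν + k)) + -1ℤ * (τ - σ)
        id₁ = solve-∀
        id₂ : ∀ z z' z₀ k τ → z - (z₀ + (1ℤ + k) * τ) ≡ 1ℤ * (z - (z' + τ)) + 1ℤ * (z' - (z₀ + k * τ))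
        id₂ = solve-∀
        from : (∃ λ z' → Value z' × z' ≈ σ * (ν + + k)) → z ≡ z₀ + + suc k * τ
        from (z' , v' , e') = combine₂ 1ℤ 1ℤ
          (≈⇒≡ {z} {z' + τ} (≈-combine₃ 1ℤ -1ℤ -1ℤ e e' τ≈σ (id₁ z z' σ ν (+ k) τ)) (ℕ.≤-<-trans small 4∣X∣<p))
          (value-unique k (ℕ.<⇒≤ k<N) v' e') (id₂ z z' z₀ (+ k) τ)
          where
          small : ∣ z - (z' + τ) ∣ ℕ.≤ ∣ X ∣ ℕ.+ (∣ X ∣ ℕ.+ (∣ X ∣ ℕ.+ ∣ X ∣))
          small = ℕ.≤-trans (∣i-j∣≤∣i∣+∣j∣ z (z' + τ)) (ℕ.+-mono-≤ (∣Value∣≤ v)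
            (ℕ.≤-trans (∣i+j∣≤∣i∣+∣j∣ z' τ) (ℕ.+-mono-≤ (∣Value∣≤ v')
              (ℕ.≤-trans (∣i-j∣≤∣i∣+∣j∣ z₁ z₀) (ℕ.+-mono-≤ (∣Value∣≤ z₁-value) (∣Value∣≤ z₀-value))))))

      product≡ : ∀ i j → P i * R j ≡ z₀ + + r i j * τ
      product≡ i j = value-unique (r i j) (r<N i j) (inj₂ (i , j , refl)) (product≈ i j (αβ≈ i j))

      progression-value : ∀ k → k ℕ.< N → Value (z₀ + + k * τ)
      progression-value k k<N = from (value k k<N)
        where
        from : (∃ λ z → Value z × z ≈ σ * (ν + + k)) → Value (z₀ + + k * τ)
        from (z , v , e) = subst Value (value-unique k k<N v e) v

      progression≤X : ∀ k → k ℕ.< N → z₀ + + k * τ ≤ X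
      progression≤X k k<N = ≤-trans (i≤∣i∣ _) (subst (+ ∣ z₀ + + k * τ ∣ ≤_) (0<⇒+∣∣ 0<X) (+≤+ (∣Value∣≤ (progression-value k k<N))))

      -- The progression is read downwards from its largest term `X` with positive step `d`,
      -- whatever the sign of `τ`. The hypothesis `middle` ties its second term back to the residue
      -- `ν + 1` in the exceptional case.
      finish : ∀ d → 0ℤ < d → d ≈ σ ⊎ d ≈ - σ → (N ≡ 3 → X - d ≡ z₁) →
        (∀ i j → ∃ λ m → m ℕ.< N × P i * R j ≡ X - + m * d) →
        (∀ m → m ℕ.< N → Value (X - + m * d)) → CoreConclusion
      finish d 0<d d≈±σ middle product∈AP AP∈product = from (Extremal.extremal P R i₀ j₀ N d 0<P 0<R 0<d ∣P∣≤ ∣R∣≤ P≢0 R≢0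
        product∈AP 2≤N P-varies R-varies AP∈product)
        where
        -- `3σ(ν + 1) ≈ 3z₁ = 3(X - d) = 4d - 3d = d`, and `d ≈ ± σ`.
        third : N ≡ 3 → + 4 * d ≡ + 3 * X → σ * (+ 3 * (ν + 1ℤ)) ≈ d
        third N≡3 eq = ≈-combine₃ (- + 3) -1ℤ (+ 3) z₁≈ (≡⇒≈ eq) (≡⇒≈ (sym (middle N≡3))) (id σ ν z₁ X d)
          where
          id : ∀ σ ν z₁ X d → σ * (+ 3 * (ν + 1ℤ)) - d ≡ - + 3 * (z₁ - σ * (ν + + 1)) + -1ℤ * (+ 4 * d - + 3 * X) + + 3 * (z₁ - (X - d))
          id = solve-∀
        from : (∀ i → P i ≡ P i₀ ⊎ P i ≡ - P i₀) ⊎ (∀ j → R j ≡ R j₀ ⊎ R j ≡ - R j₀) ⊎ (N ≡ 3 × + 4 * d ≡ + 3 * X) → CoreConclusion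
        from (inj₁ P±) = inj₁ (i₀ , ±-classes P±)
        from (inj₂ (inj₁ R±)) = inj₂ (inj₁ (j₀ , R-±-classes R±))
        from (inj₂ (inj₂ (N≡3 , eq))) = inj₂ (inj₂ (N≡3 , Sum.map
          (λ e → ≈-cancelˡ σ≉0 (≈-trans (third N≡3 eq) (≈-trans e (≡⇒≈ (sym (*-identityʳ σ))))))
          (λ e → ≈-cancelˡ σ≉0 (≈-trans (third N≡3 eq) (≈-trans e (≡⇒≈ (id σ))))) d≈±σ))
          where
          id : ∀ σ → - σ ≡ σ * -1ℤ
          id = solve-∀

      r₀ : ℕ
      r₀ = r i₀ j₀

      X≡ : X ≡ z₀ + + r₀ * τ
      X≡ = product≡ i₀ j₀

      decreasing : τ < 0ℤ → CoreConclusion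
      decreasing τ<0 = finish (- τ) (neg-mono-< τ<0) (inj₂ (≈-combine₁ -1ℤ τ≈σ (id₁ τ σ)))
        (λ _ → combine₁ 1ℤ X≡z₀ (id₂ X z₀ z₁))
        (λ i j → r i j , r<N i j , combine₂ 1ℤ -1ℤ (product≡ i j) X≡z₀ (id₃ (P i * R j) X z₀ (+ r i j) τ))
        (λ m m<N → subst Value (combine₁ -1ℤ X≡z₀ (id₄ X z₀ (+ m) τ)) (progression-value m m<N))
        where
        id₀ : ∀ z k τ → z + (1ℤ + k) * τ - (z + k * τ) ≡ τ
        id₀ = solve-∀
        id₁ : ∀ τ σ → - τ - - σ ≡ -1ℤ * (τ - σ)
        id₁ = solve-∀
        id₂ : ∀ X z z' → X - - (z' - z) - z' ≡ 1ℤ * (X - z)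
        id₂ = solve-∀
        id₃ : ∀ q X z r τ → q - (X - r * - τ) ≡ 1ℤ * (q - (z + r * τ)) + -1ℤ * (X - z)
        id₃ = solve-∀
        id₄ : ∀ X z m τ → z + m * τ - (X - m * - τ) ≡ -1ℤ * (X - z)
        id₄ = solve-∀
        -- If `X` had a predecessor, that term would exceed it, against `progression≤X`.
        first : ∀ k → r₀ ≡ k → X ≡ z₀ + + k * τ → X ≡ z₀
        first zero _ eq = trans eq (+-identityʳ z₀)
        first (suc k) r₀≡ eq = ⊥-elim (<-irrefl refl (<-≤-trans τ<0
          (subst (0ℤ ≤_) (trans (cong (_- (z₀ + + k * τ)) eq) (id₀ z₀ (+ k) τ))
            (i≤j⇒0≤j-i (progression≤X k (ℕ.<⇒≤ (subst (ℕ._< N) r₀≡ (r<N i₀ j₀))))))))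
        X≡z₀ : X ≡ z₀
        X≡z₀ = first r₀ refl X≡

      increasing : 0ℤ < τ → CoreConclusion
      increasing 0<τ = finish τ 0<τ (inj₁ τ≈σ)
        (λ N≡3 → combine₂ 1ℤ τ X≡ (cong +_ (ℕ.suc-injective (trans last N≡3))) (id₁ X z₀ z₁ (+ r₀)))
        (λ i j → r₀ ℕ.∸ r i j , below (r i j) ,
          combine₃ 1ℤ -1ℤ τ (product≡ i j) X≡ (reflected (r i j) (r≤r₀ i j)) (id₂ (P i * R j) X z₀ (+ r i j) (+ (r₀ ℕ.∸ r i j)) (+ r₀) τ))
        (λ m m<N → subst Value (combine₂ -1ℤ τ X≡ (reflected m (ℕ.s≤s⁻¹ (subst (m ℕ.<_) (sym last) m<N))) (id₃ X z₀ (+ m) (+ (r₀ ℕ.∸ m)) (+ r₀) τ))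
          (progression-value (r₀ ℕ.∸ m) (below m)))
        where
        id₀ : ∀ z k τ → z + k * τ - (z + (1ℤ + k) * τ) ≡ - τ
        id₀ = solve-∀
        id₁ : ∀ X z z' r → X - (z' - z) - z' ≡ 1ℤ * (X - (z + r * (z' - z))) + (z' - z) * (r - + 2)
        id₁ = solve-∀
        id₂ : ∀ q X z r m r₀ τ → q - (X - m * τ) ≡ 1ℤ * (q - (z + r * τ)) + -1ℤ * (X - (z + r₀ * τ)) + τ * (m - (r₀ - r))
        id₂ = solve-∀
        id₃ : ∀ X z m k r₀ τ → z + k * τ - (X - m * τ) ≡ -1ℤ * (X - (z + r₀ * τ)) + τ * (k - (r₀ - m))
        id₃ = solve-∀
        -- Here it is a successor of `X` that would exceed it.
        last : suc r₀ ≡ N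
        last = ℕ.≤-antisym (r<N i₀ j₀) (ℕ.≮⇒≥ (λ r₀+1<N → <-irrefl refl (<-≤-trans (neg-mono-< 0<τ)
          (subst (0ℤ ≤_) (trans (cong (_- (z₀ + + suc r₀ * τ)) X≡) (id₀ z₀ (+ r₀) τ))
            (i≤j⇒0≤j-i (progression≤X (suc r₀) r₀+1<N))))))
        r≤r₀ : ∀ i j → r i j ℕ.≤ r₀
        r≤r₀ i j = ℕ.s≤s⁻¹ (subst (r i j ℕ.<_) (sym last) (r<N i j))
        below : ∀ m → r₀ ℕ.∸ m ℕ.< N
        below m = ℕ.≤-<-trans (ℕ.m∸n≤m r₀ m) (r<N i₀ j₀)
        reflected : ∀ m → m ℕ.≤ r₀ → + (r₀ ℕ.∸ m) ≡ + r₀ - + m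
        reflected m m≤r₀ = sym (trans (m-n≡m⊖n r₀ m) (⊖-≥ m≤r₀))

      core′ : CoreConclusion
      core′ = by-sign (<-cmp 0ℤ τ)
        where
        by-sign : Tri (0ℤ < τ) (0ℤ ≡ τ) (τ < 0ℤ) → CoreConclusion
        by-sign (tri< 0<τ _ _) = increasing 0<τ
        by-sign (tri≈ _ 0≡τ _) = ⊥-elim (σ≉0 (≈-trans (≈-sym τ≈σ) (≡⇒≈ (sym 0≡τ))))
        by-sign (tri> _ _ τ<0) = decreasing τ<0

    abstract
      core : CoreConclusion
      core = Integral.core′ (Rank.multiplier D large) (Rank.multiplier (swap D) large) N≤p 32N<p
        where
        N≤p : N ℕ.≤ p
        N≤p = ℕ.≤-trans (subst (ℕ._≤ N ℕ.* 20772) (ℕ.*-identityʳ N) (ℕ.*-monoʳ-≤ N (ℕ.≤ᵇ⇒≤ 1 20772 tt))) large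
        32N<p : N ℕ.* 32 ℕ.< p
        32N<p = ℕ.<-≤-trans (ℕ.*-monoʳ-< N {{ℕ.>-nonZero (ℕ.<-≤-trans (s≤s z≤n) (Facts.t≤N D N≤p zero))}}
          (ℕ.<ᵇ⇒< 32 20772 tt)) large

-- Residues as elements of Fin p

enum : ∀ {n} (S : Subset n) → Fin (card S) → Fin n
enum (inside  ∷ S) zero    = zero
enum (inside  ∷ S) (suc i) = suc (enum S i)
enum (outside ∷ S) i       = suc (enum S i)

enum-∈ : ∀ {n} (S : Subset n) i → enum S i ∈ S
enum-∈ (inside  ∷ S) zero    = here
enum-∈ (inside  ∷ S) (suc i) = there (enum-∈ S i)
enum-∈ (outside ∷ S) i       = there (enum-∈ S i)

enum-injective : ∀ {n} (S : Subset n) → Injective _≡_ _≡_ (enum S)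
enum-injective (inside  ∷ S) {zero}  {zero}  eq = refl
enum-injective (inside  ∷ S) {suc i} {suc j} eq = cong suc (enum-injective S (sucᶠ-injective eq))
enum-injective (outside ∷ S) eq = enum-injective S (sucᶠ-injective eq)

enum-surjective : ∀ {n} (S : Subset n) {x} → x ∈ S → ∃ λ i → enum S i ≡ x
enum-surjective (inside  ∷ S) here = zero , refl
enum-surjective (inside  ∷ S) (there x∈S) with i , eq ← enum-surjective S x∈S = suc i , cong suc eq
enum-surjective (outside ∷ S) (there x∈S) with i , eq ← enum-surjective S x∈S = i , cong suc eq

injective⇒≤card : ∀ {m n} (S : Subset n) (h : Fin m → Fin n) → Injective _≡_ _≡_ h → (∀ i → h i ∈ S) → m ℕ.≤ card S
injective⇒≤card S h h-injective h∈S = injective⇒≤ {f = λ i → proj₁ (enum-surjective S (h∈S i))}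
  (λ {i} {j} eq → h-injective (trans (sym (proj₂ (enum-surjective S (h∈S i))))
    (trans (cong (enum S) eq) (proj₂ (enum-surjective S (h∈S j))))))

_⇔-dec_ : ∀ {P Q : Set} → Dec P → Dec Q → Dec (P ⇔ Q)
P? ⇔-dec Q? = map′ (λ (f , g) → mk⇔ f g) (λ e → Equivalence.to e , Equivalence.from e)
  ((P? →-dec Q?) ×-dec (Q? →-dec P?))

another : ∀ {s} → 2 ℕ.≤ s → (i : Fin s) → ∃ λ i' → i' ≢ i
another (s≤s (s≤s _)) zero    = suc zero , λ ()
another (s≤s (s≤s _)) (suc i) = zero , λ ()

0<1/20772 : 0ℚ ℚ.< mkℚ (+ 1) 20771 (1-coprimeTo 20772)
0<1/20772 = *<* (+<+ (s≤s z≤n))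

clear-denominators : ∀ m p → (+ m ℚ./ 1) ℚ.< mkℚ (+ 1) 20771 (1-coprimeTo 20772) ℚ.* (+ p ℚ./ 1) → m ℕ.* 20772 ℕ.< p
clear-denominators m p lt = drop‿+<+ (subst₂ _<_ (sym (pos-* m 20772)) (trans (*-identityʳ (+ 1 * + p)) (*-identityˡ (+ p)))
  (ℚᵘ.drop-*<* (ℚᵘ.<-respˡ-≃ (ℚ.toℚᵘ-fromℚᵘ (mkℚᵘ (+ m) 0)) (ℚᵘ.<-respʳ-≃ (ℚᵘ.≃-trans
    (ℚ.toℚᵘ-homo-* (mkℚ (+ 1) 20771 (1-coprimeTo 20772)) (+ p ℚ./ 1))
    (ℚᵘ.*-congˡ {mkℚᵘ (+ 1) 20771} (ℚ.toℚᵘ-fromℚᵘ (mkℚᵘ (+ p) 0)))) (ℚ.toℚᵘ-mono-< lt)))))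

module Residues (p : ℕ) .{{_ : NonZero p}} (p-prime : Prime p) where
  open Modular p
  open Field p-prime
  open Decompositions p p-prime
  open Core p p-prime

  p≈0 : + p ≈ 0ℤ
  p≈0 = congruent (Signed.divides 1ℤ (trans (+-identityʳ (+ p)) (sym (*-identityˡ (+ p)))))

  ⟦mulF⟧ : ∀ a b → ⟦ mulF p a b ⟧ ≈ ⟦ a ⟧ * ⟦ b ⟧
  ⟦mulF⟧ a b = ≈-trans (⟦[]⟧ (toℕ a ℕ.* toℕ b)) (≡⇒≈ (pos-* (toℕ a) (toℕ b)))

  ⟦negF⟧ : ∀ a → ⟦ negF p a ⟧ ≈ - ⟦ a ⟧
  ⟦negF⟧ a = ≈-trans (⟦[]⟧ (p ℕ.∸ toℕ a)) (≈-combine₂ 1ℤ 1ℤ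
    (≡⇒≈ (sym (trans (m-n≡m⊖n p (toℕ a)) (⊖-≥ (ℕ.<⇒≤ (toℕ<n a)))))) p≈0 (id (+ (p ℕ.∸ toℕ a)) (+ p) ⟦ a ⟧))
    where
    id : ∀ d p a → d - - a ≡ 1ℤ * (d - (p - a)) + 1ℤ * (p - 0ℤ)
    id = solve-∀

  ⟦addOne⟧ : ∀ a → ⟦ addOne p a ⟧ ≈ ⟦ a ⟧ + 1ℤ
  ⟦addOne⟧ a = ⟦[]⟧ (toℕ a ℕ.+ 1)

  ⟦subOne⟧ : ∀ a → ⟦ subOne p a ⟧ ≈ ⟦ a ⟧ - 1ℤ
  ⟦subOne⟧ a = ≈-trans (⟦[]⟧ (toℕ a ℕ.+ (p ℕ.∸ 1))) (≈-combine₂ 1ℤ 1ℤ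
    (≡⇒≈ (sym (⊖-≥ {p} {1} (ℕ.>-nonZero⁻¹ p)))) p≈0 (id ⟦ a ⟧ (+ (p ℕ.∸ 1)) (+ p)))
    where
    id : ∀ a d p → a + d - (a - 1ℤ) ≡ 1ℤ * (d - (p - 1ℤ)) + 1ℤ * (p - 0ℤ)
    id = solve-∀

  ⟦⟧-≡ : ∀ {x y z} → ⟦ x ⟧ ≈ z → ⟦ y ⟧ ≈ z → x ≡ y
  ⟦⟧-≡ e e' = ⟦⟧-injective (≈-trans e (≈-sym e'))

  neg-cong : ∀ {x y} → x ≈ y → - x ≈ - y
  neg-cong {x} {y} e = ≈-combine₁ -1ℤ e (id x y)
    where
    id : ∀ x y → - x - - y ≡ -1ℤ * (x - y)
    id = solve-∀

  *-cong-≈ : ∀ {x y x' y'} → x ≈ y → x' ≈ y' → x * x' ≈ y * y'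
  *-cong-≈ {x} {y} {x'} {y'} e e' = ≈-combine₂ x' y e e' (id x y x' y')
    where
    id : ∀ x y x' y' → x * x' - y * y' ≡ x' * (x - y) + y * (x' - y')
    id = solve-∀

  negF-involutive : ∀ x → negF p (negF p x) ≡ x
  negF-involutive x = ⟦⟧-≡ (≈-trans (⟦negF⟧ (negF p x)) (neg-cong (⟦negF⟧ x))) (≡⇒≈ (sym (neg-involutive ⟦ x ⟧)))

  negF-mulF : ∀ a b → negF p (mulF p a b) ≡ mulF p (negF p a) b
  negF-mulF a b = ⟦⟧-≡ (≈-trans (⟦negF⟧ (mulF p a b)) (neg-cong (⟦mulF⟧ a b)))
    (≈-trans (⟦mulF⟧ (negF p a) b) (≈-trans (*-cong-≈ (⟦negF⟧ a) ≈-refl) (≡⇒≈ (sym (neg-distribˡ-* ⟦ a ⟧ ⟦ b ⟧)))))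

  mulF-comm : ∀ a b → mulF p a b ≡ mulF p b a
  mulF-comm a b = cong ([_] p) (ℕ.*-comm (toℕ a) (toℕ b))

  -- Intervals of residues and the final alternative

  module Interval (n N : ℕ) where

    I : Subset p
    I = interval p n N

    ν : ℤ
    ν = + n + 1ℤ

    member≈ : ∀ k → ⟦ [_] p (n ℕ.+ suc k) ⟧ ≈ ν + + k
    member≈ k = ≈-trans (⟦[]⟧ (n ℕ.+ suc k)) (≡⇒≈ (sym (+-assoc (+ n) 1ℤ (+ k))))

    ∈-interval⁻ : ∀ N {x} → x ∈ intervalUpTo p n N → ∃ λ k → k ℕ.< N × ⟦ x ⟧ ≈ ν + + k
    ∈-interval⁻ zero x∈ = ⊥-elim (∉⊥ x∈)
    ∈-interval⁻ (suc N) x∈ = Sum.[ (λ x∈ → N , ℕ.n<1+n N , subst (λ y → ⟦ y ⟧ ≈ ν + + N) (sym (x∈⁅y⁆⇒x≡y _ x∈)) (member≈ N)) ,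
      (λ x∈ → let k , k<N , e = ∈-interval⁻ N x∈ in k , ℕ.m≤n⇒m≤1+n k<N , e) ] (x∈p∪q⁻ _ (intervalUpTo p n N) x∈)

    ∈-interval⁺ : ∀ N {x} k → k ℕ.< N → ⟦ x ⟧ ≈ ν + + k → x ∈ intervalUpTo p n N
    ∈-interval⁺ (suc N) {x} k k<N e with k ℕ.≟ N
    ... | yes refl = x∈p∪q⁺ (inj₁ (subst (λ y → x ∈ ⁅ y ⁆) (⟦⟧-≡ e (member≈ k)) (x∈⁅x⁆ x)))
    ... | no k≢N = x∈p∪q⁺ (inj₂ (∈-interval⁺ N k (ℕ.≤∧≢⇒< (ℕ.s≤s⁻¹ k<N) k≢N) e))

    card-lower : ∀ m → m ℕ.≤ N → m ℕ.≤ p → m ℕ.≤ card I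
    card-lower m m≤N m≤p = injective⇒≤card I (λ k → res (ν + + toℕ k))
      (λ {k} {l} eq → toℕ-injective (+-≈-cancel {ν} m≤p (toℕ<n k) (toℕ<n l)
        (≈-trans (≈-sym (⟦res⟧ (ν + + toℕ k))) (≈-trans (≡⇒≈ (cong ⟦_⟧ eq)) (⟦res⟧ (ν + + toℕ l))))))
      (λ k → ∈-interval⁺ N (toℕ k) (ℕ.<-≤-trans (toℕ<n k) m≤N) (⟦res⟧ (ν + + toℕ k)))

    -- The hypothesis bounds the cardinality, whereas the argument uses the length `N`. They agree
    -- for `N ≤ p`; a longer interval would have at least `p` elements, too many for the hypothesis.
    length-bound : card I ℕ.* 20772 ℕ.< p → N ℕ.* 20772 ℕ.≤ p
    length-bound small with N ℕ.≤? p
    ... | yes N≤p = ℕ.≤-trans (ℕ.*-monoˡ-≤ 20772 (card-lower N ℕ.≤-refl N≤p)) (ℕ.<⇒≤ small)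
    ... | no N≰p = ⊥-elim (ℕ.<-irrefl refl (ℕ.≤-<-trans (ℕ.≤-trans (ℕ.m≤m*n p 20772)
      (ℕ.*-monoˡ-≤ 20772 (card-lower p (ℕ.<⇒≤ (ℕ.≰⇒> N≰p)) ℕ.≤-refl))) small))

    MinusZeroIsProd-swap : ∀ {A B} → MinusZeroIsProd p I A B → MinusZeroIsProd p I B A
    MinusZeroIsProd-swap AB x = mk⇔
      (λ x∈ → let a , b , a∈ , b∈ , eq = Equivalence.to (AB x) x∈ in b , a , b∈ , a∈ , trans eq (mulF-comm a b))
      (λ (b , a , b∈ , a∈ , eq) → Equivalence.from (AB x) (a , b , a∈ , b∈ , trans eq (mulF-comm b a)))

    factor≉0 : ∀ {A B} → MinusZeroIsProd p I A B → ∀ {a b} → a ∈ A → b ∈ B → ¬ ⟦ a ⟧ ≈ 0ℤ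
    factor≉0 AB {a} {b} a∈A b∈B e = proj₂ (Equivalence.from (AB (mulF p a b)) (a , b , a∈A , b∈B , refl))
      (⟦⟧-≡ (≈-trans (⟦mulF⟧ a b) (≈-trans (*-cong-≈ e ≈-refl) (≡⇒≈ (*-zeroˡ ⟦ b ⟧)))) (⟦[]⟧ 0))

    module _ {A B : Subset p} (2≤A : 2 ℕ.≤ card A) (2≤B : 2 ℕ.≤ card B) (AB : MinusZeroIsProd p I A B) where

      private
        product∈I : ∀ i j → mulF p (enum A i) (enum B j) ∈ I
        product∈I i j = proj₁ (Equivalence.from (AB _) (enum A i , enum B j , enum-∈ A i , enum-∈ B j , refl))

        some : ∀ {s} → 2 ℕ.≤ s → Fin s
        some 2≤s = fromℕ< (ℕ.<-≤-trans (s≤s z≤n) 2≤s)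

        cover : ∀ k → k ℕ.< N → ν + + k ≈ 0ℤ ⊎ ∃ λ i → ∃ λ j → ⟦ enum A i ⟧ * ⟦ enum B j ⟧ ≈ ν + + k
        cover k k<N = by-zero (x ≟ᶠ zeroF p)
          where
          x : Fin p
          x = res (ν + + k)
          by-zero : Dec (x ≡ zeroF p) → ν + + k ≈ 0ℤ ⊎ ∃ λ i → ∃ λ j → ⟦ enum A i ⟧ * ⟦ enum B j ⟧ ≈ ν + + k
          by-zero (yes x≡0) = inj₁ (≈-trans (≈-sym (⟦res⟧ (ν + + k))) (subst (λ y → ⟦ y ⟧ ≈ 0ℤ) (sym x≡0) (⟦[]⟧ 0)))
          by-zero (no x≢0) = inj₂ (from (Equivalence.to (AB x) (∈-interval⁺ N k k<N (⟦res⟧ (ν + + k)) , x≢0)))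
            where
            from : InProd p A B x → ∃ λ i → ∃ λ j → ⟦ enum A i ⟧ * ⟦ enum B j ⟧ ≈ ν + + k
            from (a , b , a∈A , b∈B , x≡ab) with enum-surjective A a∈A | enum-surjective B b∈B
            ... | i , refl | j , refl = i , j , ≈-trans (≈-sym (⟦mulF⟧ (enum A i) (enum B j))) (subst (λ y → ⟦ y ⟧ ≈ ν + + k) x≡ab (⟦res⟧ (ν + + k)))

      decomposition : Decomposition N ν (card A) (card B)
      decomposition = record
        { α = λ i → ⟦ enum A i ⟧
        ; β = λ j → ⟦ enum B j ⟧
        ; α-injective = λ e → enum-injective A (⟦⟧-injective e)
        ; β-injective = λ e → enum-injective B (⟦⟧-injective e)
        ; α≉0 = λ i → factor≉0 AB (enum-∈ A i) (enum-∈ B (some 2≤B))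
        ; β≉0 = λ j → factor≉0 (MinusZeroIsProd-swap AB) (enum-∈ B j) (enum-∈ A (some 2≤A))
        ; r = λ i j → proj₁ (∈-interval⁻ N (product∈I i j))
        ; r<N = λ i j → proj₁ (proj₂ (∈-interval⁻ N (product∈I i j)))
        ; αβ≈ = λ i j → ≈-trans (≈-sym (⟦mulF⟧ (enum A i) (enum B j))) (proj₂ (proj₂ (∈-interval⁻ N (product∈I i j))))
        ; cover = cover
        }

    -- The classes only give `A` inside `{a, -a}`; a second element of `A` shows that `-a` really
    -- occurs.
    isPlusMinus : ∀ {A} → 2 ℕ.≤ card A → (∃ λ i₀ → ∀ i → ⟦ enum A i ⟧ ≈ ⟦ enum A i₀ ⟧ ⊎ ⟦ enum A i ⟧ ≈ - ⟦ enum A i₀ ⟧) →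
      ∃ λ r → IsPlusMinus p A r
    isPlusMinus {A} 2≤A (i₀ , classes) = a , λ x → mk⇔ (to x) Sum.[ (λ eq → subst (_∈ A) (sym eq) (enum-∈ A i₀)) , (λ eq → subst (_∈ A) (sym eq) -a∈A) ]
      where
      a : Fin p
      a = enum A i₀
      to : ∀ x → x ∈ A → x ≡ a ⊎ x ≡ negF p a
      to x x∈A with enum-surjective A x∈A
      ... | i , refl = Sum.map ⟦⟧-injective (λ e → ⟦⟧-≡ e (⟦negF⟧ a)) (classes i)
      -a∈A : negF p a ∈ A
      -a∈A with another 2≤A i₀
      ... | i , i≢i₀ with classes i
      ...   | inj₁ e = ⊥-elim (i≢i₀ (enum-injective A (⟦⟧-injective e)))
      ...   | inj₂ e = subst (_∈ A) (⟦⟧-≡ e (⟦negF⟧ a)) (enum-∈ A i)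

    -- A nonzero element is some `ab`, and `-(ab) = (-a)b` with `-a` again in `A`; zero is its own
    -- negative.
    neg-closed : ∀ {A B r} → MinusZeroIsProd p I A B → IsPlusMinus p A r → ∀ x → x ∈ I → negF p x ∈ I
    neg-closed {A} {B} {r} AB A±r x x∈I = by-zero (x ≟ᶠ zeroF p)
      where
      -∈A : ∀ {a} → a ∈ A → negF p a ∈ A
      -∈A {a} a∈A = Equivalence.from (A±r (negF p a)) (Sum.[ (λ a≡r → inj₂ (cong (negF p) a≡r)) ,
        (λ a≡-r → inj₁ (trans (cong (negF p) a≡-r) (negF-involutive r))) ] (Equivalence.to (A±r a) a∈A))
      by-zero : Dec (x ≡ zeroF p) → negF p x ∈ I
      by-zero (yes refl) = subst (_∈ I) (⟦⟧-≡ (⟦[]⟧ 0) (≈-trans (⟦negF⟧ (zeroF p)) (neg-cong (⟦[]⟧ 0)))) x∈I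
      by-zero (no x≢0) with Equivalence.to (AB x) (x∈I , x≢0)
      ... | a , b , a∈A , b∈B , refl = proj₁ (Equivalence.from (AB (negF p (mulF p a b)))
        (negF p a , b , -∈A a∈A , b∈B , negF-mulF a b))

    negSymmetric : ∀ {A B r} → MinusZeroIsProd p I A B → IsPlusMinus p A r → NegSymmetric p I
    negSymmetric AB A±r x = mk⇔ (neg-closed AB A±r x)
      (λ -x∈I → subst (_∈ I) (negF-involutive x) (neg-closed AB A±r (negF p x) -x∈I))

    Triple : Set
    Triple = Σ (Fin p) λ t → IsInvThree p t × (IsTriple p I t ⊎ IsNegTriple p I t)

    -- The second alternative speaks of all decompositions, so the choice between the alternatives
    -- cannot be read off from the given one. Deciding `Triple` beforehand excludes the exceptional
    -- case for every decomposition at once.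
    triple? : Dec Triple
    triple? = any? λ t → (mulF p ([_] p 3) t ≟ᶠ [_] p 1) ×-dec
      ((all? λ x → (x ∈? I) ⇔-dec ((x ≟ᶠ subOne p t) ⊎-dec ((x ≟ᶠ t) ⊎-dec (x ≟ᶠ addOne p t)))) ⊎-dec
       (all? λ x → (x ∈? I) ⇔-dec ((x ≟ᶠ negF p (subOne p t)) ⊎-dec ((x ≟ᶠ negF p t) ⊎-dec (x ≟ᶠ negF p (addOne p t))))))

    members : N ≡ 3 → ∀ {u v w} → ⟦ u ⟧ ≈ ν + + 0 → ⟦ v ⟧ ≈ ν + + 1 → ⟦ w ⟧ ≈ ν + + 2 →
      ∀ x → x ∈ I ⇔ (x ≡ u ⊎ x ≡ v ⊎ x ≡ w)
    members refl u≈ v≈ w≈ x = mk⇔ (λ x∈I → to (∈-interval⁻ 3 x∈I)) from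
      where
      to : (∃ λ k → k ℕ.< 3 × ⟦ x ⟧ ≈ ν + + k) → x ≡ _ ⊎ x ≡ _ ⊎ x ≡ _
      to (0 , _ , e) = inj₁ (⟦⟧-≡ e u≈)
      to (1 , _ , e) = inj₂ (inj₁ (⟦⟧-≡ e v≈))
      to (2 , _ , e) = inj₂ (inj₂ (⟦⟧-≡ e w≈))
      to (suc (suc (suc _)) , s≤s (s≤s (s≤s ())) , _)
      from : x ≡ _ ⊎ x ≡ _ ⊎ x ≡ _ → x ∈ I
      from (inj₁ refl) = ∈-interval⁺ 3 0 (s≤s z≤n) u≈
      from (inj₂ (inj₁ refl)) = ∈-interval⁺ 3 1 (s≤s (s≤s z≤n)) v≈
      from (inj₂ (inj₂ refl)) = ∈-interval⁺ 3 2 (s≤s (s≤s (s≤s z≤n))) w≈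

    invThree : ∀ {t z} → ⟦ t ⟧ ≈ z → + 3 * z ≈ 1ℤ → IsInvThree p t
    invThree {t} t≈ e = ⟦⟧-≡ (≈-trans (⟦mulF⟧ ([_] p 3) t) (≈-trans (*-cong-≈ (⟦[]⟧ 3) t≈) e)) (⟦[]⟧ 1)

    -- The inverse of `3` is the middle element `ν + 1` or its negative. In the latter case negation
    -- reverses the order, so the first element `ν` corresponds to `-(t + 1)`.
    triple : N ≡ 3 → + 3 * (ν + 1ℤ) ≈ 1ℤ ⊎ + 3 * (ν + 1ℤ) ≈ -1ℤ → Triple
    triple N≡3 (inj₁ e) = t , invThree t≈ e , inj₁ (members N≡3
        (≈-combine₂ 1ℤ 1ℤ (⟦subOne⟧ t) t≈ (id₀ ⟦ subOne p t ⟧ ⟦ t ⟧ ν)) t≈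
        (≈-combine₂ 1ℤ 1ℤ (⟦addOne⟧ t) t≈ (id₂ ⟦ addOne p t ⟧ ⟦ t ⟧ ν)))
      where
      t : Fin p
      t = res (ν + 1ℤ)
      t≈ : ⟦ t ⟧ ≈ ν + 1ℤ
      t≈ = ⟦res⟧ (ν + 1ℤ)
      id₀ : ∀ z t ν → z - (ν + + 0) ≡ 1ℤ * (z - (t - 1ℤ)) + 1ℤ * (t - (ν + 1ℤ))
      id₀ = solve-∀
      id₂ : ∀ z t ν → z - (ν + + 2) ≡ 1ℤ * (z - (t + 1ℤ)) + 1ℤ * (t - (ν + 1ℤ))
      id₂ = solve-∀
    triple N≡3 (inj₂ e) = t , invThree t≈ (≈-combine₁ -1ℤ e (id ν)) , inj₂ (λ x → mk⇔
        (reverse ∘ Equivalence.to (ordered x)) (Equivalence.from (ordered x) ∘ reverse))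
      where
      t : Fin p
      t = res (- (ν + 1ℤ))
      t≈ : ⟦ t ⟧ ≈ - (ν + 1ℤ)
      t≈ = ⟦res⟧ (- (ν + 1ℤ))
      id : ∀ ν → + 3 * - (ν + 1ℤ) - 1ℤ ≡ -1ℤ * (+ 3 * (ν + 1ℤ) - -1ℤ)
      id = solve-∀
      id₀ : ∀ z y t ν → z - (ν + + 0) ≡ 1ℤ * (z - - y) + -1ℤ * (y - (t + 1ℤ)) + -1ℤ * (t - - (ν + 1ℤ))
      id₀ = solve-∀
      id₁ : ∀ z t ν → z - (ν + + 1) ≡ 1ℤ * (z - - t) + -1ℤ * (t - - (ν + 1ℤ))
      id₁ = solve-∀
      id₂ : ∀ z y t ν → z - (ν + + 2) ≡ 1ℤ * (z - - y) + -1ℤ * (y - (t - 1ℤ)) + -1ℤ * (t - - (ν + 1ℤ))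
      id₂ = solve-∀
      ordered : ∀ x → x ∈ I ⇔ (x ≡ negF p (addOne p t) ⊎ x ≡ negF p t ⊎ x ≡ negF p (subOne p t))
      ordered = members N≡3
        (≈-combine₃ 1ℤ -1ℤ -1ℤ (⟦negF⟧ (addOne p t)) (⟦addOne⟧ t) t≈ (id₀ ⟦ negF p (addOne p t) ⟧ ⟦ addOne p t ⟧ ⟦ t ⟧ ν))
        (≈-combine₂ 1ℤ -1ℤ (⟦negF⟧ t) t≈ (id₁ ⟦ negF p t ⟧ ⟦ t ⟧ ν))
        (≈-combine₃ 1ℤ -1ℤ -1ℤ (⟦negF⟧ (subOne p t)) (⟦subOne⟧ t) t≈ (id₂ ⟦ negF p (subOne p t) ⟧ ⟦ subOne p t ⟧ ⟦ t ⟧ ν))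
      reverse : ∀ {X Y Z : Set} → X ⊎ Y ⊎ Z → Z ⊎ Y ⊎ X
      reverse (inj₁ x) = inj₂ (inj₂ x)
      reverse (inj₂ (inj₁ y)) = inj₂ (inj₁ y)
      reverse (inj₂ (inj₂ z)) = inj₁ z

    module _ (large : N ℕ.* 20772 ℕ.≤ p) where

      classification : ∀ {s t} → 2 ℕ.≤ s → 2 ℕ.≤ t → (D : Decomposition N ν s t) → let open Decomposition D in
        (∃ λ i₀ → ∀ i → α i ≈ α i₀ ⊎ α i ≈ - α i₀) ⊎ (∃ λ j₀ → ∀ j → β j ≈ β j₀ ⊎ β j ≈ - β j₀) ⊎
        (N ≡ 3 × (+ 3 * (ν + 1ℤ) ≈ 1ℤ ⊎ + 3 * (ν + 1ℤ) ≈ -1ℤ))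
      classification (s≤s (s≤s _)) (s≤s (s≤s _)) D = core D large

      plus-minus : ¬ Triple → ∀ A B → 2 ℕ.≤ card A → 2 ℕ.≤ card B → MinusZeroIsProd p I A B →
        Σ (Fin p) λ r → IsPlusMinus p A r ⊎ IsPlusMinus p B r
      plus-minus ¬triple A B 2≤A 2≤B AB = from (classification 2≤A 2≤B (decomposition 2≤A 2≤B AB))
        where
        from : _ → Σ (Fin p) λ r → IsPlusMinus p A r ⊎ IsPlusMinus p B r
        from (inj₁ classes) = let r , A±r = isPlusMinus 2≤A classes in r , inj₁ A±r
        from (inj₂ (inj₁ classes)) = let r , B±r = isPlusMinus 2≤B classes in r , inj₂ B±r
        from (inj₂ (inj₂ (N≡3 , e))) = ⊥-elim (¬triple (triple N≡3 e))

      dichotomy : HasNontrivialDecomp p I → Dec Triple → Triple ⊎ (NegSymmetric p I ×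
        (∀ A B → 2 ℕ.≤ card A → 2 ℕ.≤ card B → MinusZeroIsProd p I A B → Σ (Fin p) λ r → IsPlusMinus p A r ⊎ IsPlusMinus p B r))
      dichotomy _ (yes t) = inj₁ t
      dichotomy (A , B , 2≤A , 2≤B , AB) (no ¬t) = inj₂
        (Sum.[ negSymmetric AB , negSymmetric (MinusZeroIsProd-swap AB) ] (proj₂ (plus-minus ¬t A B 2≤A 2≤B AB)) , plus-minus ¬t)

theorem1 : Σ ℚ λ c → 0ℚ ℚ.< c ×
    ((p : ℕ) .{{_ : NonZero p}} → Prime p → (n N : ℕ) →
    (+ card (interval p n N) ℚ./ 1) ℚ.< c ℚ.* (+ p ℚ./ 1) →
    HasNontrivialDecomp p (interval p n N) →
    (Σ (Fin p) λ t → IsInvThree p t ×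
    (IsTriple p (interval p n N) t ⊎ IsNegTriple p (interval p n N) t))
    ⊎
    (NegSymmetric p (interval p n N) ×
    ((A B : Subset p) → 2 ℕ.≤ card A → 2 ℕ.≤ card B →
    MinusZeroIsProd p (interval p n N) A B →
    Σ (Fin p) λ r → IsPlusMinus p A r ⊎ IsPlusMinus p B r)))
theorem1 = mkℚ (+ 1) 20771 (1-coprimeTo 20772) , 0<1/20772 , λ p p-prime n N small decomposable →
  let open Residues p p-prime
      open Interval n N
  in dichotomy (length-bound (clear-denominators (card (interval p n N)) p small)) decomposable triple?
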